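{- Let $n$ be an odd positive integer, let $d,e$ be positive integers with $\gcd(n,d)=\gcd(n,e)=1$, and let $q=2^n$. For $k\in\{d,e\}$ let $\mathcal{O}_k=\{(y^{2^k}+y,\,y): y\in\mathbb{F}_q\}\cup\{(0),(1)\}$, a hyperoval in $\Pi(\mathbb{K}_n^{td})$. Then $\mathcal{O}_d$ and $\mathcal{O}_e$ are equivalent if and only if $d\equiv\pm e\pmod n$.
   Context: $\mathrm{Tr}:\mathbb{F}_q\to\mathbb{F}_2$ is the absolute trace. $\mathbb{K}_n^{td}=(\mathbb{F}_q,+,\circ)$ ($n$ odd) is the presemifield with $x\circ y=xy+\mathrm{Tr}(x)\,y^{2^{n-1}}+\mathrm{Tr}(x^2y)$. The plane $\Pi(\mathbb{K}_n^{td})$ has affine points $(a,b)$, $a,b\in\mathbb{F}_q$, points at infinity $(a)$, $a\in\mathbb{F}_q\cup\{\infty\}$, and lines: the line at infinity (all points $(a)$); $l_a=\{(a,y):y\in\mathbb{F}_q\}\cup\{(\infty)\}$ for $a\in\mathbb{F}_q$; $l_{a,b}=\{(x,y):y=x\circ a+b\}\cup\{(a)\}$ for $a,b\in\mathbb{F}_q$. Two hyperovals are equivalent if some collineation of the plane maps one onto the other. -}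

module Defs where

open import Level using (0ℓ)
open import Data.Nat using (ℕ; zero; suc; _∸_; _^_)
open import Data.Fin using (Fin)
open import Data.Maybe using (Maybe; just; nothing)
open import Data.Product using (Σ; _×_)
open import Data.Sum using (_⊎_)
open import Data.Empty using (⊥)
open import Data.Unit using (⊤)
open import Relation.Binary.PropositionalEquality using (_≡_)
open import Relation.Nullary using (¬_)
open import Function.Bundles using (_⤖_; Bijection)
open import Algebra.Structures using (IsCommutativeRing)

-- A finite field with exactly 2^n elements (equality is propositional).
-- Such a field is unique up to isomorphism, so this models F_q, q = 2^n.
record FiniteField2^ (n : ℕ) : Set₁ where
  infixl 6 _+_
  infixl 7 _*_
  field
    Carrier : Set
    _+_ _*_ : Carrier → Carrier → Carrier
    -_      : Carrier → Carrier
    0# 1#   : Carrier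
    isCommutativeRing : IsCommutativeRing _≡_ _+_ _*_ -_ 0# 1#
    0≢1     : ¬ (0# ≡ 1#)
    inverse : ∀ x → ¬ (x ≡ 0#) → Σ Carrier (λ y → x * y ≡ 1#)
    enum    : Carrier ⤖ Fin (2 ^ n)

module _ {n : ℕ} (F : FiniteField2^ n) where
  open FiniteField2^ F

  pow2 : ℕ → Carrier → Carrier
  pow2 zero    x = x
  pow2 (suc k) x = let y = pow2 k x in y * y

  trSum : ℕ → Carrier → Carrier
  trSum zero    x = 0#
  trSum (suc m) x = trSum m x + pow2 m x

  Tr : Carrier → Carrier
  Tr = trSum n

  _∘_ : Carrier → Carrier → Carrier
  x ∘ y = x * y + Tr x * pow2 (n ∸ 1) y + Tr (x * x * y)

  -- points of Π(K_n^{td}): affine (a,b), and at infinity (a) with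
  -- a ∈ F_q ∪ {∞} (nothing = ∞)
  data Point : Set where
    aff : Carrier → Carrier → Point
    inf : Maybe Carrier → Point

  data Line : Set where
    lineInf : Line
    vert    : Carrier → Line
    lin     : Carrier → Carrier → Line

  _I_ : Point → Line → Set
  aff x y        I lineInf = ⊥
  inf _          I lineInf = ⊤
  aff x y        I vert a  = x ≡ a
  inf nothing    I vert a  = ⊤
  inf (just _)   I vert a  = ⊥
  aff x y        I lin a b = y ≡ x ∘ a + b
  inf nothing    I lin a b = ⊥
  inf (just c)   I lin a b = c ≡ a

  record Collineation : Set where
    field
      onPoints : Point ⤖ Point
      onLines  : Line ⤖ Line
      preserves : ∀ P L →
        (P I L → Bijection.to onPoints P I Bijection.to onLines L) ×
        (Bijection.to onPoints P I Bijection.to onLines L → P I L)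

  PointSet : Set₁
  PointSet = Point → Set

  Equivalent : PointSet → PointSet → Set
  Equivalent A B = Σ Collineation λ c →
    ∀ P → (A P → B (Bijection.to (Collineation.onPoints c) P)) ×
          (B (Bijection.to (Collineation.onPoints c) P) → A P)

  O : ℕ → PointSet
  O k (aff x y) = x ≡ pow2 k y + y
  O k (inf nothing)  = ⊥
  O k (inf (just c)) = (c ≡ 0#) ⊎ (c ≡ 1#)

{-# OPTIONS --safe #-}
module Submission where

-- The shear (x , y) ↦ (x , y + x) swaps (0) and (1) and carries O_d to O_{-d}, which gives the
-- equivalences.  Conversely let φ carry O_d to O_e.
--
-- For n ≤ 3 the condition d ≡ ±e always holds.  For n ≥ 5 the plane is far from Desarguesian: if φ moved the line at infinity, its conjugates of
-- translations would be elations making the inverses of the maps y ↦ u ∘ y closed under addition,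
-- and if φ moved (∞), a conjugate of a shear would be (x , y) ↦ (x + y , y); both are refuted by
-- explicit trace conditions, met by nonzero elements since four F₂-functionals on F_q have a common
-- nonzero zero.  So φ fixes the line at infinity and (∞), hence, after a translation along O_e and
-- possibly the shear above, also the origin, (0) and (1).  Then φ (x , y) = (β x , β y) with
-- β (x ∘ a) = β x ∘ γ a, and the hyperovals give β (x^(2^d)) = (β x)^(2^e).
--
-- Since d is prime to n, this forces Tr (β x) = Tr x, so that β (x a) and β x · γ a differ by an
-- element of F₂ whenever Tr x = 0.  Comparing many x shows that γ is multiplicative and
-- intertwines the two Frobenius powers.  As γ is onto, x^(2^d) = x^(2^e) for all x.

open import Defs
open import Level using (0ℓ)
open import Algebra.Bundles using (CommutativeMonoid; CommutativeRing; RawRing)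
import Algebra.Properties.CommutativeMonoid.Sum as Sum
import Algebra.Properties.Ring as RingProperties
import Algebra.Solver.Ring as RingSolver
open import Algebra.Solver.Ring.AlmostCommutativeRing using (AlmostCommutativeRing; fromCommutativeRing; _-Raw-AlmostCommutative⟶_; Induced-equivalence)
open import Data.Bool using (Bool; true; false; _xor_; _∧_; if_then_else_)
open import Data.Empty using (⊥; ⊥-elim)
open import Data.Fin using (Fin; zero; suc)
import Data.Fin as Fin
import Data.Fin.Properties as Fin
open import Data.Fin.Permutation using (permutation)
open import Data.List using (List; []; _∷_; length; lookup)
open import Data.List.Relation.Unary.All as All using (All; []; _∷_)
import Data.List.Relation.Unary.All.Properties as All
open import Data.List.Properties using (tabulate-lookup)
open import Data.Maybe using (just; nothing)
open import Data.Nat using (ℕ; NonZero; _%_; _<_; _^_; _≤_; _∸_; z≤n; s≤s)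
import Data.Nat as ℕ
import Data.Nat.Properties as ℕ
import Data.Nat.DivMod as ℕ
open import Data.Nat.GCD using (gcd; gcd-greatest; module Bézout)
open import Data.Nat.Divisibility using (_∣_; ∣-refl; ∣1⇒≡1; m%n≡0⇒n∣m)
open import Data.Nat.Coprimality using (coprime-Bézout; gcd≡1⇒coprime)
open import Data.Product using (∃; _×_; _,_; proj₁; proj₂)
open import Data.Sum using (_⊎_; inj₁; inj₂)
open import Data.Vec using (Vec; []; _∷_; replicate)
open import Data.Unit using (tt)
open import Function.Base using (case_of_)
open import Function.Bundles using (Inverse; _↔_; mk⤖)
open import Function.Properties.Bijection using (⤖⇒↔)
open import Relation.Binary.PropositionalEquality using (_≡_; _≢_; refl; sym; trans; cong; cong₂; subst; module ≡-Reasoning)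
open import Relation.Binary.Definitions using (WeaklyDecidable)
open import Relation.Nullary using (¬_; Dec; yes; no)

-- Counting in the finite field: characteristic 2, Frobenius powers and x^q = x.

module Arithmetic {n : ℕ} (F : FiniteField2^ n) where
  open FiniteField2^ F

  ring : CommutativeRing 0ℓ 0ℓ
  ring = record { isCommutativeRing = isCommutativeRing }

  module R = CommutativeRing ring
  module P = RingProperties R.ring

  enumeration : Carrier ↔ Fin (2 ^ n)
  enumeration = ⤖⇒↔ enum

  index : Carrier → Fin (2 ^ n)
  index = Inverse.to enumeration

  element : Fin (2 ^ n) → Carrier
  element = Inverse.from enumeration

  element-index : ∀ x → element (index x) ≡ x
  element-index = Inverse.strictlyInverseʳ enumeration

  index-element : ∀ i → index (element i) ≡ i
  index-element = Inverse.strictlyInverseˡ enumeration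

  _≟_ : (x y : Carrier) → Dec (x ≡ y)
  x ≟ y with index x Fin.≟ index y
  ... | yes eq = yes (trans (sym (element-index x)) (trans (cong element eq) (element-index y)))
  ... | no neq = no λ eq → neq (cong index eq)

  *-zero-or : ∀ {x y} → x * y ≡ 0# → x ≡ 0# ⊎ y ≡ 0#
  *-zero-or {x} {y} xy≡0 with x ≟ 0#
  ... | yes x≡0 = inj₁ x≡0
  ... | no x≢0 with inverse x x≢0
  ...   | x⁻¹ , inv = inj₂ (begin
    y               ≡⟨ R.*-identityˡ y ⟨
    1# * y          ≡⟨ cong (_* y) (trans (R.*-comm x⁻¹ x) inv) ⟨
    x⁻¹ * x * y     ≡⟨ R.*-assoc _ _ _ ⟩
    x⁻¹ * (x * y)   ≡⟨ cong (x⁻¹ *_) xy≡0 ⟩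
    x⁻¹ * 0#        ≡⟨ R.zeroʳ _ ⟩
    0#              ∎)
    where open ≡-Reasoning

  *-nonzero : ∀ {x y} → x ≢ 0# → y ≢ 0# → x * y ≢ 0#
  *-nonzero x≢0 y≢0 xy≡0 with *-zero-or xy≡0
  ... | inj₁ x≡0 = x≢0 x≡0
  ... | inj₂ y≡0 = y≢0 y≡0

  module _ (M : CommutativeMonoid 0ℓ 0ℓ) where
    private
      module M = CommutativeMonoid M
      module MS = Sum M

    sum-reindex : (g : Carrier → M.Carrier) (h k : Carrier → Carrier) →
      (∀ x → h (k x) ≡ x) → (∀ x → k (h x) ≡ x) →
      MS.sum (λ i → g (element i)) M.≈ MS.sum (λ i → g (h (element i)))
    sum-reindex g h k hk kh =
      M.trans (MS.sum-permute (λ i → g (element i)) π)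
        (MS.sum-cong-≋ {2 ^ n} λ i → M.reflexive (cong g (element-index (h (element i)))))
      where
      π = permutation (λ i → index (h (element i))) (λ i → index (k (element i)))
        (λ i → trans (cong (λ z → index (h z)) (element-index _)) (trans (cong index (hk _)) (index-element i)))
        (λ i → trans (cong (λ z → index (k z)) (element-index _)) (trans (cong index (kh _)) (index-element i)))

    -- Kept general in the monoid: read additively it doubles, which yields the characteristic; read
    -- multiplicatively it squares, which turns a constant product into a Frobenius power.
    sum-const-double : ∀ m x → MS.sum {2 ^ ℕ.suc m} (λ _ → x) M.≈ MS.sum {2 ^ m} (λ _ → x) M.∙ MS.sum {2 ^ m} (λ _ → x)
    sum-const-double m x = begin
      MS.sum {2 ^ ℕ.suc m} (λ _ → x)                          ≈⟨ MS.sum-replicate (2 ^ ℕ.suc m) ⟩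
      (2 ^ m ℕ.+ (2 ^ m ℕ.+ 0)) ×′ x                          ≈⟨ ×-homo-+ x (2 ^ m) (2 ^ m ℕ.+ 0) ⟩
      ((2 ^ m) ×′ x) M.∙ ((2 ^ m ℕ.+ 0) ×′ x)                   ≈⟨ M.∙-congˡ (M.reflexive (cong (_×′ x) (ℕ.+-identityʳ (2 ^ m)))) ⟩
      ((2 ^ m) ×′ x) M.∙ ((2 ^ m) ×′ x)                           ≈⟨ M.∙-cong (MS.sum-replicate (2 ^ m)) (MS.sum-replicate (2 ^ m)) ⟨
      MS.sum {2 ^ m} (λ _ → x) M.∙ MS.sum {2 ^ m} (λ _ → x)   ∎
      where
      open import Algebra.Properties.Monoid.Mult M.monoid renaming (_×_ to _×′_) using (×-homo-+)
      open import Relation.Binary.Reasoning.Setoid M.setoid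

  module Add = Sum R.+-commutativeMonoid
  module Mul = Sum R.*-commutativeMonoid

  -- The map x ↦ x + 1 permutes the field, so the sum of all elements does not change when q ones
  -- are added to it.
  sum-1≡0 : Add.sum {2 ^ n} (λ _ → 1#) ≡ 0#
  sum-1≡0 = P.+-cancelˡ _ _ _ (begin
    Add.sum element + Add.sum {2 ^ n} (λ _ → 1#)  ≡⟨ Add.∑-distrib-+ element (λ _ → 1#) ⟨
    Add.sum (λ i → element i + 1#)                ≡⟨ sum-reindex R.+-commutativeMonoid (λ x → x) (_+ 1#) (_+ - 1#)
                                                       (λ x → trans (R.+-assoc _ _ _) (trans (cong (x +_) (R.-‿inverseˡ 1#)) (R.+-identityʳ x)))
                                                       (λ x → trans (R.+-assoc _ _ _) (trans (cong (x +_) (R.-‿inverseʳ 1#)) (R.+-identityʳ x))) ⟨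
    Add.sum element                               ≡⟨ R.+-identityʳ _ ⟨
    Add.sum element + 0#                          ∎)
    where open ≡-Reasoning

  -- The sum of 2^n ones is (1 + 1)^n, which could not vanish in a field if 1 + 1 were nonzero.
  char-2 : 1# + 1# ≡ 0#
  char-2 with (1# + 1#) ≟ 0#
  ... | yes eq = eq
  ... | no neq = ⊥-elim (nonzero n sum-1≡0)
    where
    nonzero : ∀ m → Add.sum {2 ^ m} (λ _ → 1#) ≢ 0#
    nonzero ℕ.zero eq = 0≢1 (trans (sym eq) (R.+-identityʳ 1#))
    nonzero (ℕ.suc m) eq = *-nonzero neq (nonzero m) (begin
      (1# + 1#) * s      ≡⟨ R.distribʳ _ _ _ ⟩
      1# * s + 1# * s    ≡⟨ cong₂ _+_ (R.*-identityˡ s) (R.*-identityˡ s) ⟩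
      s + s              ≡⟨ sum-const-double R.+-commutativeMonoid m 1# ⟨
      Add.sum {2 ^ ℕ.suc m} (λ _ → 1#)  ≡⟨ eq ⟩
      0#                 ∎)
      where
      open ≡-Reasoning
      s = Add.sum {2 ^ m} (λ _ → 1#)

  x+x≡0 : ∀ x → x + x ≡ 0#
  x+x≡0 x = begin
    x + x               ≡⟨ cong₂ _+_ (R.*-identityˡ x) (R.*-identityˡ x) ⟨
    1# * x + 1# * x     ≡⟨ R.distribʳ _ _ _ ⟨
    (1# + 1#) * x       ≡⟨ cong (_* x) char-2 ⟩
    0# * x              ≡⟨ R.zeroˡ x ⟩
    0#                  ∎
    where open ≡-Reasoning

  -x≡x : ∀ x → - x ≡ x
  -x≡x x = sym (P.+-inverseˡ-unique x x (x+x≡0 x))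

  boolRing : RawRing 0ℓ 0ℓ
  boolRing = record { Carrier = Bool ; _≈_ = _≡_ ; _+_ = _xor_ ; _*_ = _∧_ ; -_ = λ b → b ; 0# = false ; 1# = true }

  fieldACR : AlmostCommutativeRing 0ℓ 0ℓ
  fieldACR = fromCommutativeRing ring

  boolMorphism : boolRing -Raw-AlmostCommutative⟶ fieldACR
  boolMorphism = record
    { ⟦_⟧    = λ b → if b then 1# else 0#
    ; +-homo = λ { true true → sym char-2 ; true false → sym (R.+-identityʳ _)
                 ; false true → sym (R.+-identityˡ _) ; false false → sym (R.+-identityˡ _) }
    ; *-homo = λ { true true → sym (R.*-identityˡ _) ; true false → sym (R.*-identityˡ _)
                 ; false true → sym (R.zeroˡ _) ; false false → sym (R.zeroˡ _) }
    ; -‿homo = λ b → sym (-x≡x _)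
    ; 0-homo = refl
    ; 1-homo = refl
    }

  boolCoefficients≟ : WeaklyDecidable (Induced-equivalence boolMorphism)
  boolCoefficients≟ true true   = just refl
  boolCoefficients≟ false false = just refl
  boolCoefficients≟ _ _         = nothing

  -- With coefficients in Bool = F₂ the ring solver works modulo characteristic 2.
  module Char2Solver = RingSolver boolRing fieldACR boolMorphism boolCoefficients≟
  open Char2Solver using (solve; _:=_; _:+_; _:*_; con)

  frob : ℕ → Carrier → Carrier
  frob = pow2 F

  frob-+ : ∀ k x y → frob k (x + y) ≡ frob k x + frob k y
  frob-+ ℕ.zero x y = refl
  frob-+ (ℕ.suc k) x y = trans (cong (λ z → z * z) (frob-+ k x y))
    (solve 2 (λ a b → (a :+ b) :* (a :+ b) := a :* a :+ b :* b) refl (frob k x) (frob k y))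

  frob-* : ∀ k x y → frob k (x * y) ≡ frob k x * frob k y
  frob-* ℕ.zero x y = refl
  frob-* (ℕ.suc k) x y = trans (cong (λ z → z * z) (frob-* k x y))
    (solve 2 (λ a b → (a :* b) :* (a :* b) := (a :* a) :* (b :* b)) refl (frob k x) (frob k y))

  frob-0 : ∀ k → frob k 0# ≡ 0#
  frob-0 ℕ.zero = refl
  frob-0 (ℕ.suc k) = trans (cong (λ z → z * z) (frob-0 k)) (R.zeroˡ 0#)

  frob-1 : ∀ k → frob k 1# ≡ 1#
  frob-1 ℕ.zero = refl
  frob-1 (ℕ.suc k) = trans (cong (λ z → z * z) (frob-1 k)) (R.*-identityˡ 1#)

  frob-∘ : ∀ j k x → frob (j ℕ.+ k) x ≡ frob j (frob k x)
  frob-∘ ℕ.zero k x = refl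
  frob-∘ (ℕ.suc j) k x = cong (λ z → z * z) (frob-∘ j k x)

  frob-comm : ∀ j k x → frob j (frob k x) ≡ frob k (frob j x)
  frob-comm j k x = trans (sym (frob-∘ j k x)) (trans (cong (λ i → frob i x) (ℕ.+-comm j k)) (frob-∘ k j x))

  frob-nonzero : ∀ k {x} → x ≢ 0# → frob k x ≢ 0#
  frob-nonzero ℕ.zero x≢0 = x≢0
  frob-nonzero (ℕ.suc k) x≢0 = *-nonzero (frob-nonzero k x≢0) (frob-nonzero k x≢0)

  frob-fixed : ∀ k d x → frob d x ≡ x → frob (k ℕ.* d) x ≡ x
  frob-fixed ℕ.zero d x eq = refl
  frob-fixed (ℕ.suc k) d x eq = trans (frob-∘ d (k ℕ.* d) x) (trans (cong (frob d) (frob-fixed k d x eq)) eq)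

  product-const : ∀ m a → Mul.sum {2 ^ m} (λ _ → a) ≡ frob m a
  product-const ℕ.zero a = R.*-identityʳ a
  product-const (ℕ.suc m) a = trans (sum-const-double R.*-commutativeMonoid m a) (cong (λ z → z * z) (product-const m a))

  -- In `frob-n` the exceptional index is that of the zero element; the extra factor `a` fills the
  -- gap there.
  product-except-one : ∀ {N} a (f : Fin N → Carrier) i₀ → f i₀ ≡ 1# → (∀ i → i ≢ i₀ → f i ≡ a) →
    a * Mul.sum f ≡ Mul.sum {N} (λ _ → a)
  product-except-one a f zero f₀ fᵢ = cong (a *_) (trans (cong₂ _*_ f₀ refl)
    (trans (R.*-identityˡ _) (Mul.sum-cong-≗ λ i → fᵢ (suc i) λ ())))
  product-except-one a f (suc i₀) f₀ fᵢ = cong (a *_) (trans (cong₂ _*_ (fᵢ zero λ ()) refl)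
    (product-except-one a (λ i → f (suc i)) i₀ f₀ λ i i≢ → fᵢ (suc i) λ eq → i≢ (Fin.suc-injective eq)))

  product-nonzero : ∀ {N} (f : Fin N → Carrier) → (∀ i → f i ≢ 0#) → Mul.sum f ≢ 0#
  product-nonzero {ℕ.zero} f nz eq = 0≢1 (sym eq)
  product-nonzero {ℕ.suc N} f nz = *-nonzero (nz zero) (product-nonzero (λ i → f (suc i)) λ i → nz (suc i))

  -- Overriding the value at 0 lets a product over the nonzero elements run over the whole
  -- enumeration.
  ifZero : Carrier → Carrier → Carrier → Carrier
  ifZero u v x with x ≟ 0#
  ... | yes _ = u
  ... | no _  = v

  ifZero-yes : ∀ {u v x} → x ≡ 0# → ifZero u v x ≡ u
  ifZero-yes {x = x} x≡0 with x ≟ 0#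
  ... | yes _  = refl
  ... | no x≢0 = ⊥-elim (x≢0 x≡0)

  ifZero-no : ∀ {u v x} → x ≢ 0# → ifZero u v x ≡ v
  ifZero-no {x = x} x≢0 with x ≟ 0#
  ... | yes x≡0 = ⊥-elim (x≢0 x≡0)
  ... | no _    = refl

  *-cancelˡ : ∀ {a x y} → a ≢ 0# → a * x ≡ a * y → x ≡ y
  *-cancelˡ {a} {x} {y} a≢0 eq with *-zero-or {a} {x + y} (trans (R.distribˡ a x y) (trans (cong (_+ a * y) eq) (x+x≡0 _)))
  ... | inj₁ a≡0 = ⊥-elim (a≢0 a≡0)
  ... | inj₂ x+y≡0 = trans (P.+-inverseˡ-unique x y x+y≡0) (-x≡x y)

  -- Multiplication by a permutes the nonzero elements, so their product is unchanged by it.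
  frob-n : ∀ a → frob n a ≡ a
  frob-n a with a ≟ 0#
  ... | yes refl = frob-0 n
  ... | no a≢0 with inverse a a≢0
  ...   | a⁻¹ , aa⁻¹≡1 = begin
    frob n a                                ≡⟨ product-const n a ⟨
    Mul.sum {2 ^ n} (λ _ → a)               ≡⟨ product-except-one a (λ i → k (element i)) (index 0#)
                                                 (ifZero-yes (element-index 0#))
                                                 (λ i i≢ → ifZero-no λ eq → i≢ (trans (sym (index-element i)) (cong index eq))) ⟨
    a * Mul.sum (λ i → k (element i))       ≡⟨ cong (a *_) (*-cancelˡ Πh≢0 Πh*Πk) ⟩
    a * 1#                                  ≡⟨ R.*-identityʳ a ⟩
    a                                       ∎
    where
    open ≡-Reasoning
    h k : Carrier → Carrier
    h x = ifZero 1# x x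
    k x = ifZero 1# a x
    h-nonzero : ∀ x → h x ≢ 0#
    h-nonzero x eq with x ≟ 0#
    ... | yes _  = 0≢1 (sym eq)
    ... | no x≢0 = x≢0 eq
    h-a* : ∀ x → h (a * x) ≡ h x * k x
    h-a* x with x ≟ 0#
    ... | yes refl = trans (ifZero-yes (R.zeroʳ a)) (sym (R.*-identityˡ 1#))
    ... | no x≢0   = trans (ifZero-no (*-nonzero a≢0 x≢0)) (R.*-comm a x)
    Πh Πk : Carrier
    Πh = Mul.sum (λ i → h (element i))
    Πk = Mul.sum (λ i → k (element i))
    Πh≢0 : Πh ≢ 0#
    Πh≢0 = product-nonzero (λ i → h (element i)) (λ i → h-nonzero (element i))
    Πh*Πk : Πh * Πk ≡ Πh * 1#
    Πh*Πk = begin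
      Πh * Πk                                       ≡⟨ Mul.∑-distrib-+ (λ i → h (element i)) (λ i → k (element i)) ⟨
      Mul.sum (λ i → h (element i) * k (element i)) ≡⟨ Mul.sum-cong-≗ {2 ^ n} (λ i → h-a* (element i)) ⟨
      Mul.sum (λ i → h (a * element i))             ≡⟨ sum-reindex R.*-commutativeMonoid h (a *_) (a⁻¹ *_)
                                                         (λ x → trans (sym (R.*-assoc _ _ _)) (trans (cong (_* x) aa⁻¹≡1) (R.*-identityˡ x)))
                                                         (λ x → trans (sym (R.*-assoc _ _ _)) (trans (cong (_* x) (trans (R.*-comm _ _) aa⁻¹≡1)) (R.*-identityˡ x))) ⟨
      Πh                                            ≡⟨ R.*-identityʳ Πh ⟨
      Πh * 1#                                       ∎

  frob-periodic : ∀ j k x → frob (j ℕ.+ k ℕ.* n) x ≡ frob j x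
  frob-periodic j k x = trans (frob-∘ j (k ℕ.* n) x) (cong (frob j) (frob-fixed k n x (frob-n x)))

-- Traces, F₂-functionals and the order of the Frobenius map.

module Trace {n : ℕ} (n-odd : n % 2 ≡ 1) (F : FiniteField2^ n) where
  open FiniteField2^ F
  open Arithmetic F
  open Char2Solver using (solve; _:=_; _:+_; _:*_; con)

  Additive : (Carrier → Carrier) → Set
  Additive f = ∀ x y → f (x + y) ≡ f x + f y

  additive-0 : ∀ {f} → Additive f → f 0# ≡ 0#
  additive-0 {f} add = trans (cong f (sym (R.+-identityˡ 0#))) (trans (add 0# 0#) (x+x≡0 _))

  x+y≡0⇒x≡y : ∀ {x y} → x + y ≡ 0# → x ≡ y
  x+y≡0⇒x≡y {x} {y} eq = trans (P.+-inverseˡ-unique x y eq) (-x≡x y)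

  +-cancelʳ : ∀ {x y} z → x + z ≡ y + z → x ≡ y
  +-cancelʳ {x} {y} z = P.+-cancelʳ z x y

  IsBit : Carrier → Set
  IsBit x = x ≡ 0# ⊎ x ≡ 1#

  idempotent⇒bit : ∀ {x} → x * x ≡ x → IsBit x
  idempotent⇒bit {x} eq with *-zero-or {x} {x + 1#}
      (trans (solve 1 (λ x → x :* (x :+ con true) := x :* x :+ x) refl x) (trans (cong (_+ x) eq) (x+x≡0 x)))
  ... | inj₁ x≡0 = inj₁ x≡0
  ... | inj₂ x+1≡0 = inj₂ (x+y≡0⇒x≡y x+1≡0)

  bit-idempotent : ∀ {x} → IsBit x → x * x ≡ x
  bit-idempotent (inj₁ refl) = R.zeroˡ 0#
  bit-idempotent (inj₂ refl) = R.*-identityˡ 1#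

  bit-+ : ∀ {x y} → IsBit x → IsBit y → IsBit (x + y)
  bit-+ (inj₁ refl) (inj₁ refl) = inj₁ (x+x≡0 0#)
  bit-+ (inj₁ refl) (inj₂ refl) = inj₂ (R.+-identityˡ 1#)
  bit-+ (inj₂ refl) (inj₁ refl) = inj₂ (R.+-identityʳ 1#)
  bit-+ (inj₂ refl) (inj₂ refl) = inj₁ (x+x≡0 1#)

  frob-bit : ∀ k {x} → IsBit x → frob k x ≡ x
  frob-bit k (inj₁ refl) = frob-0 k
  frob-bit k (inj₂ refl) = frob-1 k

  tr : Carrier → Carrier
  tr = Tr F

  trSum-+ : ∀ m → Additive (trSum F m)
  trSum-+ ℕ.zero x y = sym (R.+-identityˡ 0#)
  trSum-+ (ℕ.suc m) x y = trans (cong₂ _+_ (trSum-+ m x y) (frob-+ m x y))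
    (solve 4 (λ a b c d → (a :+ b) :+ (c :+ d) := (a :+ c) :+ (b :+ d)) refl _ _ _ _)

  tr-+ : Additive tr
  tr-+ = trSum-+ n

  frob-square : ∀ k x → frob k (x * x) ≡ frob k x * frob k x
  frob-square k x = frob-* k x x

  -- Squaring shifts the exponents 0, ..., m - 1 of the partial trace to 1, ..., m, so only the end
  -- terms differ. For m = n these agree, whence Tr (x²) = Tr x.
  trSum-square : ∀ m x → trSum F m (x * x) + x ≡ trSum F m x + frob m x
  trSum-square ℕ.zero x = refl
  trSum-square (ℕ.suc m) x = begin
    trSum F m (x * x) + frob m (x * x) + x         ≡⟨ solve 3 (λ a b c → a :+ b :+ c := (a :+ c) :+ b) refl _ _ _ ⟩
    (trSum F m (x * x) + x) + frob m (x * x)       ≡⟨ cong₂ _+_ (trSum-square m x) (frob-square m x) ⟩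
    trSum F m x + frob m x + frob m x * frob m x   ∎
    where open ≡-Reasoning

  square-trSum : ∀ m x → trSum F m x * trSum F m x ≡ trSum F m (x * x)
  square-trSum ℕ.zero x = R.zeroˡ 0#
  square-trSum (ℕ.suc m) x = trans
    (solve 2 (λ a b → (a :+ b) :* (a :+ b) := a :* a :+ b :* b) refl _ _)
    (cong₂ _+_ (square-trSum m x) (sym (frob-square m x)))

  tr-square : ∀ x → tr (x * x) ≡ tr x
  tr-square x = +-cancelʳ x (trans (trSum-square n x) (cong (tr x +_) (frob-n x)))

  tr-bit : ∀ x → IsBit (tr x)
  tr-bit x = idempotent⇒bit (trans (square-trSum n x) (tr-square x))

  -- All summands are 1 and cancel two at a time, hence the induction in steps of two.
  trSum-1 : ∀ m → m % 2 ≡ 1 → trSum F m 1# ≡ 1#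
  trSum-1 1 _ = R.+-identityˡ 1#
  trSum-1 (ℕ.suc (ℕ.suc m)) odd = begin
    trSum F m 1# + frob m 1# + frob m 1# * frob m 1#   ≡⟨ cong (λ z → trSum F m 1# + z + z * z) (frob-1 m) ⟩
    trSum F m 1# + 1# + 1# * 1#                        ≡⟨ solve 1 (λ t → t :+ con true :+ con true :* con true := t) refl _ ⟩
    trSum F m 1#                                       ≡⟨ trSum-1 m odd ⟩
    1#                                                 ∎
    where open ≡-Reasoning

  tr-1 : tr 1# ≡ 1#
  tr-1 = trSum-1 n n-odd

  instance
    n-nonZero : NonZero n
    n-nonZero = ℕ.≢-nonZero λ { refl → case n-odd of λ () }

  -- The inverse of squaring, because one more squaring gives `frob n`; this is the power of y that
  -- occurs in x ∘ y.
  √ : Carrier → Carrier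
  √ = pow2 F (n ∸ 1)

  √-square : ∀ x → √ x * √ x ≡ x
  √-square x = trans (cong (λ m → frob m x) (ℕ.suc-pred n)) (frob-n x)

  √-+ : Additive √
  √-+ = frob-+ (n ∸ 1)

  √-1 : √ 1# ≡ 1#
  √-1 = frob-1 (n ∸ 1)

  tr-frob : ∀ k x → tr (frob k x) ≡ tr x
  tr-frob ℕ.zero x = refl
  tr-frob (ℕ.suc k) x = trans (tr-square (frob k x)) (tr-frob k x)

  frob-invariant-iterate : ∀ {A : Set} d (g : Carrier → A) → (∀ x → g (frob d x) ≡ g x) →
    ∀ k x → g (frob (k ℕ.* d) x) ≡ g x
  frob-invariant-iterate d g inv ℕ.zero x = refl
  frob-invariant-iterate d g inv (ℕ.suc k) x = trans (cong g (frob-∘ d (k ℕ.* d) x))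
    (trans (inv _) (frob-invariant-iterate d g inv k x))

  -- The Frobenius power x ↦ x^(2^d) generates the Galois group when d is prime to n.
  frob-invariant : ∀ {A : Set} d → gcd n d ≡ 1 → (g : Carrier → A) →
    (∀ x → g (frob d x) ≡ g x) → ∀ x → g (x * x) ≡ g x
  frob-invariant d coprime g inv x with coprime-Bézout (gcd≡1⇒coprime {n} {d} coprime)
  ... | Bézout.+- i j eq = begin
    g (x * x)                       ≡⟨ frob-invariant-iterate d g inv j (x * x) ⟨
    g (frob (j ℕ.* d) (frob 1 x))   ≡⟨ cong g (frob-comm (j ℕ.* d) 1 x) ⟩
    g (frob (1 ℕ.+ j ℕ.* d) x)      ≡⟨ cong (λ k → g (frob k x)) eq ⟩
    g (frob (i ℕ.* n) x)            ≡⟨ cong g (frob-periodic 0 i x) ⟩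
    g x                             ∎
    where open ≡-Reasoning
  ... | Bézout.-+ i j eq = begin
    g (x * x)                       ≡⟨ cong g (frob-periodic 1 i x) ⟨
    g (frob (1 ℕ.+ i ℕ.* n) x)      ≡⟨ cong (λ k → g (frob k x)) eq ⟩
    g (frob (j ℕ.* d) x)            ≡⟨ frob-invariant-iterate d g inv j x ⟩
    g x                             ∎
    where open ≡-Reasoning

  -- Bézout combines the period n of every element with the period d of x, so that squaring fixes x.
  -- The two cases are the two signs of the Bézout identity over ℕ.
  frob-fixed⇒bit : ∀ d → gcd n d ≡ 1 → ∀ x → frob d x ≡ x → IsBit x
  frob-fixed⇒bit d coprime x fix with coprime-Bézout (gcd≡1⇒coprime {n} {d} coprime)
  ... | Bézout.+- i j eq = idempotent⇒bit (begin
    frob 1 x                    ≡⟨ cong (frob 1) (frob-fixed j d x fix) ⟨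
    frob (1 ℕ.+ j ℕ.* d) x      ≡⟨ cong (λ k → frob k x) eq ⟩
    frob (i ℕ.* n) x            ≡⟨ frob-periodic 0 i x ⟩
    x                           ∎)
    where open ≡-Reasoning
  ... | Bézout.-+ i j eq = idempotent⇒bit (begin
    frob 1 x                    ≡⟨ frob-periodic 1 i x ⟨
    frob (1 ℕ.+ i ℕ.* n) x      ≡⟨ cong (λ k → frob k x) eq ⟩
    frob (j ℕ.* d) x            ≡⟨ frob-fixed j d x fix ⟩
    x                           ∎)
    where open ≡-Reasoning

  -- F₂-linear forms on F_q, with F₂ realized as the elements 0 and 1 of the field.
  record Functional : Set where
    field
      fun      : Carrier → Carrier
      additive : Additive fun
      bit      : ∀ x → IsBit (fun x)

  open Functional

  traceOf : Carrier → Functional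
  traceOf c = record
    { fun = λ x → tr (c * x)
    ; additive = λ x y → trans (cong tr (R.distribˡ c x y)) (tr-+ _ _)
    ; bit = λ x → tr-bit _ }

  traceOfSquare : Carrier → Functional
  traceOfSquare c = record
    { fun = λ x → tr (x * x * c)
    ; additive = λ x y → trans (cong tr (solve 3 (λ c x y → (x :+ y) :* (x :+ y) :* c := x :* x :* c :+ y :* y :* c) refl c x y)) (tr-+ _ _)
    ; bit = λ x → tr-bit _ }

  bitCode : Carrier → Fin 2
  bitCode x with x ≟ 0#
  ... | yes _ = zero
  ... | no _  = suc zero

  bitCode-injective : ∀ {x y} → IsBit x → IsBit y → bitCode x ≡ bitCode y → x ≡ y
  bitCode-injective {x} {y} bx by eq with x ≟ 0# | y ≟ 0#
  bitCode-injective bx by eq | yes x≡0 | yes y≡0 = trans x≡0 (sym y≡0)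
  bitCode-injective bx by () | yes _ | no _
  bitCode-injective bx by () | no _ | yes _
  bitCode-injective (inj₁ x≡0) by eq | no x≢0 | no _ = ⊥-elim (x≢0 x≡0)
  bitCode-injective bx (inj₁ y≡0) eq | no _ | no y≢0 = ⊥-elim (y≢0 y≡0)
  bitCode-injective (inj₂ x≡1) (inj₂ y≡1) eq | no _ | no _ = trans x≡1 (sym y≡1)

  Kernel : List Functional → Carrier → Set
  Kernel fs x = All (λ f → fun f x ≡ 0#) fs

  abstract
    -- Pigeonhole: r functionals take at most 2^r joint values on 2^n elements, and the sum of two
    -- elements with the same values lies in every kernel.
    kernel-nontrivial : ∀ fs → length fs < n → ∃ λ x → x ≢ 0# × Kernel fs x
    kernel-nontrivial fs r<n with Fin.pigeonhole (ℕ.^-monoʳ-< 2 (s≤s (s≤s z≤n)) r<n)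
        (λ i → Fin.funToFin (λ k → bitCode (fun (lookup fs k) (element i))))
    ... | i , j , i<j , same = element i + element j , nonzero , subst (All _) (tabulate-lookup fs) (All.tabulate⁺ in-kernel)
      where
      nonzero : element i + element j ≢ 0#
      nonzero eq = ℕ.<⇒≢ i<j (cong Fin.toℕ (trans (sym (index-element i))
        (trans (cong index (x+y≡0⇒x≡y eq)) (index-element j))))
      in-kernel : ∀ k → fun (lookup fs k) (element i + element j) ≡ 0#
      in-kernel k = trans (additive f _ _) (trans (cong (_+ fun f (element j)) agree) (x+x≡0 _))
        where
        f : Functional
        f = lookup fs k
        agree : fun f (element i) ≡ fun f (element j)
        agree = bitCode-injective (bit f _) (bit f _) (trans (sym (Fin.finToFun-funToFin _ k))
          (trans (cong (λ c → Fin.finToFun c k) same) (Fin.finToFun-funToFin _ k)))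

    -- A second kernel element is forced to differ from x by adding the functional z ↦ Tr(z/x), which is 1 at x.
    kernel-two : ∀ fs → ℕ.suc (length fs) < n →
      ∃ λ x → ∃ λ y → x ≢ 0# × y ≢ 0# × x ≢ y × Kernel fs x × Kernel fs y
    kernel-two fs r<n with kernel-nontrivial fs (ℕ.<-trans (ℕ.n<1+n _) r<n)
    ... | x , x≢0 , kx with inverse x x≢0
    ...   | x⁻¹ , xx⁻¹≡1 with kernel-nontrivial (traceOf x⁻¹ ∷ fs) r<n
    ...     | y , y≢0 , h ∷ ky = x , y , x≢0 , y≢0 , x≢y , kx , ky
      where
      x≢y : x ≢ y
      x≢y refl = 0≢1 (trans (sym h) (trans (cong tr (trans (R.*-comm _ _) xx⁻¹≡1)) tr-1))

  -- If w were nonzero, both products would be 1, forcing x = y. This makes identities exact that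
  -- are known up to an F₂ error at two arguments.
  bit-multiples⇒0 : ∀ {w x y} → x ≢ 0# → y ≢ 0# → x ≢ y → IsBit (w * x) → IsBit (w * y) → w ≡ 0#
  bit-multiples⇒0 {w} {x} {y} x≢0 y≢0 x≢y bx by with w ≟ 0#
  ... | yes w≡0 = w≡0
  ... | no w≢0 = ⊥-elim (x≢y (*-cancelˡ w≢0 (trans (is-1 x≢0 bx) (sym (is-1 y≢0 by)))))
    where
    is-1 : ∀ {z} → z ≢ 0# → IsBit (w * z) → w * z ≡ 1#
    is-1 z≢0 (inj₁ wz≡0) = ⊥-elim (*-nonzero w≢0 z≢0 wz≡0)
    is-1 z≢0 (inj₂ wz≡1) = wz≡1

  -- The monic polynomial of degree m with the given lower coefficients, constant term first.
  monic : ∀ {m} → Vec Carrier m → Carrier → Carrier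
  monic [] x = 1#
  monic (c ∷ cs) x = c + x * monic cs x

  -- Horner's scheme: dividing `monic (c ∷ cs)` by x + r gives as coefficients the values at r of
  -- the successive tails, starting with `cs`; the constant term `c` affects only the remainder.
  quotient : ∀ {m} → Vec Carrier m → Carrier → Vec Carrier m
  quotient [] r = []
  quotient (c ∷ cs) r = monic (c ∷ cs) r ∷ quotient cs r

  monic-division : ∀ {m} c (cs : Vec Carrier m) r x →
    monic (c ∷ cs) x ≡ (x + r) * monic (quotient cs r) x + monic (c ∷ cs) r
  monic-division c [] r x =
    solve 3 (λ c r x → c :+ x :* con true := (x :+ r) :* con true :+ (c :+ r :* con true)) refl c r x
  monic-division c (c′ ∷ cs) r x = trans (cong (λ z → c + x * z) (monic-division c′ cs r x))
    (solve 5 (λ c r x q m → c :+ x :* ((x :+ r) :* q :+ m) := (x :+ r) :* (m :+ x :* q) :+ (c :+ r :* m))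
      refl c r x (monic (quotient cs r) x) (monic (c′ ∷ cs) r))

  -- Dividing out the root `f zero` lowers the degree; the other points differ from it, so without
  -- zero divisors they are roots of the quotient.
  monic-roots : ∀ {m} (cs : Vec Carrier m) (f : Fin (ℕ.suc m) → Carrier) →
    (∀ {i j} → f i ≡ f j → i ≡ j) → ¬ (∀ i → monic cs (f i) ≡ 0#)
  monic-roots [] f inj roots = 0≢1 (sym (roots zero))
  monic-roots (c ∷ cs) f inj roots = monic-roots (quotient cs (f zero)) (λ i → f (suc i))
    (λ eq → Fin.suc-injective (inj eq)) λ i → root i
    where
    root : ∀ i → monic (quotient cs (f zero)) (f (suc i)) ≡ 0#
    root i with *-zero-or {f (suc i) + f zero} (+-cancelʳ (monic (c ∷ cs) (f zero))
        (trans (sym (monic-division c cs (f zero) (f (suc i))))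
          (trans (roots (suc i)) (sym (trans (R.+-identityˡ _) (roots zero))))))
    ... | inj₁ same = case inj (x+y≡0⇒x≡y same) of λ ()
    ... | inj₂ eq = eq

  monic-power : ∀ m x → x * monic (replicate m 0#) x ≡ Mul.sum {ℕ.suc m} (λ _ → x)
  monic-power ℕ.zero x = refl
  monic-power (ℕ.suc m) x = cong (x *_) (trans (R.+-identityˡ _) (monic-power m x))

  -- For 0 < m < n the polynomial x^(2^m) + x would vanish on all 2^n field elements, more than its
  -- degree allows.
  frob-period : ∀ m → m < n → (∀ x → frob m x ≡ x) → m ≡ 0
  frob-period ℕ.zero _ _ = refl
  frob-period m@(ℕ.suc m-1) m<n period with 2 ^ m in 2^m≡ | ℕ.^-monoʳ-≤ 2 {1} {m} (s≤s z≤n)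
  ... | 1 | s≤s ()
  -- Here 2^m = k + 2, and the coefficients are those of x^(k+2) + x; k + 3 distinct elements
  -- already exceed the degree.
  ... | ℕ.suc (ℕ.suc k) | _ = ⊥-elim (monic-roots (0# ∷ 1# ∷ replicate k 0#)
        (λ i → element (Fin.inject≤ i fits)) (λ eq → Fin.inject≤-injective fits fits _ _
          (trans (sym (index-element _)) (trans (cong index eq) (index-element _)))) λ i → root _)
    where
    open ≡-Reasoning
    fits : ℕ.suc (ℕ.suc (ℕ.suc k)) ≤ 2 ^ n
    fits = subst (_< 2 ^ n) 2^m≡ (ℕ.^-monoʳ-< 2 (s≤s (s≤s z≤n)) m<n)
    root : ∀ x → 0# + x * (1# + x * monic (replicate k 0#) x) ≡ 0#
    root x = begin
      0# + x * (1# + x * monic (replicate k 0#) x)   ≡⟨ solve 2 (λ x y → con false :+ x :* (con true :+ y) := x :+ x :* y) refl x _ ⟩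
      x + x * (x * monic (replicate k 0#) x)         ≡⟨ cong (λ y → x + x * y) (monic-power k x) ⟩
      x + Mul.sum {ℕ.suc (ℕ.suc k)} (λ _ → x)        ≡⟨ cong (λ N → x + Mul.sum {N} (λ _ → x)) 2^m≡ ⟨
      x + Mul.sum {2 ^ m} (λ _ → x)                  ≡⟨ cong (x +_) (trans (product-const m x) (period x)) ⟩
      x + x                                          ≡⟨ x+x≡0 x ⟩
      0#                                             ∎

  frob-mod : ∀ k x → frob (k % n) x ≡ frob k x
  frob-mod k x = trans (sym (frob-periodic (k % n) (k ℕ./ n) x))
    (cong (λ j → frob j x) (sym (ℕ.m≡m%n+[m/n]*n k n)))

  -- Writing x as `frob i (frob (n ∸ i) x)` cancels `frob i`, so j - i is a period below n and hence
  -- zero.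
  frob-≤-injective : ∀ i j → i ≤ j → j < n → (∀ x → frob i x ≡ frob j x) → i ≡ j
  frob-≤-injective i j i≤j j<n eq = sym (ℕ.≤-antisym (ℕ.m∸n≡0⇒m≤n (frob-period (j ∸ i) (ℕ.≤-<-trans (ℕ.m∸n≤m j i) j<n) period)) i≤j)
    where
    open ≡-Reasoning
    i≤n = ℕ.≤-trans i≤j (ℕ.<⇒≤ j<n)
    period : ∀ x → frob (j ∸ i) x ≡ x
    period x = begin
      frob (j ∸ i) x                           ≡⟨ cong (frob (j ∸ i)) (frob-n x) ⟨
      frob (j ∸ i) (frob n x)                  ≡⟨ cong (λ k → frob (j ∸ i) (frob k x)) (ℕ.m+[n∸m]≡n i≤n) ⟨
      frob (j ∸ i) (frob (i ℕ.+ (n ∸ i)) x)    ≡⟨ cong (frob (j ∸ i)) (frob-∘ i (n ∸ i) x) ⟩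
      frob (j ∸ i) (frob i (frob (n ∸ i) x))   ≡⟨ frob-∘ (j ∸ i) i _ ⟨
      frob (j ∸ i ℕ.+ i) (frob (n ∸ i) x)      ≡⟨ cong (λ k → frob k (frob (n ∸ i) x)) (ℕ.m∸n+n≡m i≤j) ⟩
      frob j (frob (n ∸ i) x)                  ≡⟨ eq (frob (n ∸ i) x) ⟨
      frob i (frob (n ∸ i) x)                  ≡⟨ frob-∘ i (n ∸ i) x ⟨
      frob (i ℕ.+ (n ∸ i)) x                   ≡⟨ cong (λ k → frob k x) (ℕ.m+[n∸m]≡n i≤n) ⟩
      frob n x                                 ≡⟨ frob-n x ⟩
      x                                        ∎

  frob-injective-mod : ∀ d e → (∀ x → frob d x ≡ frob e x) → d % n ≡ e % n
  frob-injective-mod d e eq with ℕ.≤-total (d % n) (e % n)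
  ... | inj₁ le = frob-≤-injective _ _ le (ℕ.m%n<n e n) λ x → trans (frob-mod d x) (trans (eq x) (sym (frob-mod e x)))
  ... | inj₂ le = sym (frob-≤-injective _ _ le (ℕ.m%n<n d n) λ x → trans (frob-mod e x) (trans (sym (eq x)) (sym (frob-mod d x))))

-- The presemifield product and two families of identities that it cannot satisfy.

module Presemifield {n : ℕ} (n-odd : n % 2 ≡ 1) (F : FiniteField2^ n) where
  open FiniteField2^ F
  open Arithmetic F
  open Trace n-odd F
  open Functional
  open Char2Solver using (solve; _:=_; _:+_; _:*_; con)

  infixl 7 _⊙_
  _⊙_ : Carrier → Carrier → Carrier
  _⊙_ = _∘_ F

  +-interchange : ∀ a b c d → (a + b) + (c + d) ≡ (a + c) + (b + d)
  +-interchange = solve 4 (λ a b c d → (a :+ b) :+ (c :+ d) := (a :+ c) :+ (b :+ d)) refl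

  ⊙-distribˡ : ∀ x a b → x ⊙ (a + b) ≡ x ⊙ a + x ⊙ b
  ⊙-distribˡ x a b = begin
    x * (a + b) + tr x * √ (a + b) + tr (x * x * (a + b))
      ≡⟨ cong₂ _+_ (cong₂ _+_ (R.distribˡ x a b) (trans (cong (tr x *_) (√-+ a b)) (R.distribˡ _ _ _)))
                   (additive (traceOf (x * x)) a b) ⟩
    (x * a + x * b) + (tr x * √ a + tr x * √ b) + (tr (x * x * a) + tr (x * x * b))
      ≡⟨ trans (cong₂ _+_ (+-interchange _ _ _ _) refl) (+-interchange _ _ _ _) ⟩
    x ⊙ a + x ⊙ b ∎
    where open ≡-Reasoning

  ⊙-distribʳ : ∀ a x y → (x + y) ⊙ a ≡ x ⊙ a + y ⊙ a
  ⊙-distribʳ a x y = begin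
    (x + y) * a + tr (x + y) * √ a + tr ((x + y) * (x + y) * a)
      ≡⟨ cong₂ _+_ (cong₂ _+_ (R.distribʳ a x y) (trans (cong (_* √ a) (tr-+ x y)) (R.distribʳ _ _ _)))
                   (additive (traceOfSquare a) x y) ⟩
    (x * a + y * a) + (tr x * √ a + tr y * √ a) + (tr (x * x * a) + tr (y * y * a))
      ≡⟨ trans (cong₂ _+_ (+-interchange _ _ _ _) refl) (+-interchange _ _ _ _) ⟩
    x ⊙ a + y ⊙ a ∎
    where open ≡-Reasoning

  ⊙-zeroʳ : ∀ x → x ⊙ 0# ≡ 0#
  ⊙-zeroʳ x = additive-0 (⊙-distribˡ x)

  ⊙-zeroˡ : ∀ a → 0# ⊙ a ≡ 0#
  ⊙-zeroˡ a = additive-0 (⊙-distribʳ a)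

  -- Both trace terms equal Tr x and cancel. Consequently the lines of slope 1 are y = x + b.
  ⊙-identityʳ : ∀ x → x ⊙ 1# ≡ x
  ⊙-identityʳ x = begin
    x * 1# + tr x * √ 1# + tr (x * x * 1#)   ≡⟨ cong₂ (λ s t → x * 1# + tr x * s + t) √-1 (trans (cong tr (R.*-identityʳ _)) (tr-square x)) ⟩
    x * 1# + tr x * 1# + tr x                ≡⟨ solve 2 (λ x t → x :* con true :+ t :* con true :+ t := x) refl x (tr x) ⟩
    x                                        ∎
    where open ≡-Reasoning

  -- On the trace-zero hyperplane the root term drops out, and the product is field multiplication
  -- up to an element of F₂.
  ⊙-tr0 : ∀ {x} a → tr x ≡ 0# → x ⊙ a ≡ x * a + tr (x * x * a)
  ⊙-tr0 {x} a tr≡0 = trans (cong (λ t → x * a + t * √ a + tr (x * x * a)) tr≡0)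
    (solve 3 (λ p r t → p :+ con false :* r :+ t := p :+ t) refl (x * a) (√ a) (tr (x * x * a)))

  ⊙-tr1 : ∀ {x} a → tr x ≡ 1# → x ⊙ a ≡ x * a + √ a + tr (x * x * a)
  ⊙-tr1 {x} a tr≡1 = cong (λ t → x * a + t + tr (x * x * a)) (trans (cong (_* √ a) tr≡1) (R.*-identityˡ _))

  -- If c ⊙ w = 0, then c w is the bit Tr (c² w); were it 1, that trace would equal Tr c = 0.
  ⊙-cancelˡ : ∀ {c a b} → tr c ≡ 0# → c ≢ 0# → c ⊙ a ≡ c ⊙ b → a ≡ b
  ⊙-cancelˡ {c} {a} {b} tr≡0 c≢0 eq = x+y≡0⇒x≡y (zero-divisor (trans (⊙-distribˡ c a b) (trans (cong (_+ c ⊙ b) eq) (x+x≡0 _))))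
    where
    zero-divisor : ∀ {w} → c ⊙ w ≡ 0# → w ≡ 0#
    zero-divisor {w} eq with *-zero-or {c} {w} cw≡0
      where
      cw≡tr : c * w ≡ tr (c * c * w)
      cw≡tr = x+y≡0⇒x≡y (trans (sym (⊙-tr0 w tr≡0)) eq)
      cw≡0 : c * w ≡ 0#
      cw≡0 with tr-bit (c * c * w)
      ... | inj₁ t≡0 = trans cw≡tr t≡0
      ... | inj₂ t≡1 = ⊥-elim (0≢1 (begin
        0#                ≡⟨ tr≡0 ⟨
        tr c              ≡⟨ cong tr (R.*-identityʳ c) ⟨
        tr (c * 1#)       ≡⟨ cong (λ z → tr (c * z)) (trans cw≡tr t≡1) ⟨
        tr (c * (c * w))  ≡⟨ cong tr (R.*-assoc c c w) ⟨
        tr (c * c * w)    ≡⟨ t≡1 ⟩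
        1#                ∎))
        where open ≡-Reasoning
    ... | inj₁ c≡0 = ⊥-elim (c≢0 c≡0)
    ... | inj₂ w≡0 = w≡0

  -- R_f⁻¹ = R_c⁻¹ + R_u⁻¹ for the maps R_x : a ↦ x ⊙ a, without mentioning inverses.
  HarmonicSum : Carrier → Carrier → Carrier → Set
  HarmonicSum c u f = ∀ s t → c ⊙ s ≡ u ⊙ t → f ⊙ (t + s) ≡ u ⊙ t

  harmonicSum-sym : ∀ {c u f} → HarmonicSum c u f → HarmonicSum u c f
  harmonicSum-sym {f = f} H s t eq = trans (cong (f ⊙_) (R.+-comm t s)) (trans (H t s (sym eq)) eq)

  -- Squaring removes the root, and one factor z cancels. The right-hand side no longer involves z,
  -- so two different z will force a = 0.
  square-relation : ∀ {a t d z} → z ≢ 0# → IsBit t → a * z ≡ t * √ (d * z) → a * a * z ≡ t * d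
  square-relation {a} {t} {d} {z} z≢0 t-bit az = *-cancelˡ z≢0 (begin
    z * (a * a * z)                     ≡⟨ solve 2 (λ z a → z :* (a :* a :* z) := (a :* z) :* (a :* z)) refl z a ⟩
    (a * z) * (a * z)                   ≡⟨ cong (λ w → w * w) az ⟩
    (t * r) * (t * r)                   ≡⟨ solve 2 (λ a b → (a :* b) :* (a :* b) := (a :* a) :* (b :* b)) refl t r ⟩
    (t * t) * (r * r)                   ≡⟨ cong₂ _*_ (bit-idempotent t-bit) (√-square _) ⟩
    t * (d * z)                         ≡⟨ solve 3 (λ t d z → t :* (d :* z) := z :* (t :* d)) refl t d z ⟩
    z * (t * d)                         ∎)
    where
    open ≡-Reasoning
    r : Carrier
    r = √ (d * z)

  -- This is the value that 1/f = 1/c + 1/u gives in the field. For z in the three kernels, s = u z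
  -- and t = c z turn the products into field products, leaving A z = Tr f · √((c + u) z);
  -- `square-relation` at two such z gives A = 0 and then Tr f = 0.
  harmonicSum-value : 4 < n → ∀ {c u f} → tr c ≡ 0# → tr u ≡ 0# → c + u ≢ 0# → HarmonicSum c u f →
    f * (c + u) ≡ u * c × tr f ≡ 0#
  harmonicSum-value 4<n {c} {u} {f} trc tru c+u≢0 H
    with kernel-two (traceOf (c * c * u) ∷ traceOf (u * u * c) ∷ traceOf (f * f * (c + u)) ∷ []) 4<n
  ... | z₁ , z₂ , z₁≢0 , z₂≢0 , z₁≢z₂ , k₁ , k₂ = x+y≡0⇒x≡y A≡0 , trf≡0
    where
    open ≡-Reasoning
    A : Carrier
    A = f * (c + u) + u * c
    key : ∀ z → z ≢ 0# → Kernel (traceOf (c * c * u) ∷ traceOf (u * u * c) ∷ traceOf (f * f * (c + u)) ∷ []) z →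
      A * A * z ≡ tr f * (c + u)
    key z z≢0 (h₁ ∷ h₂ ∷ h₃ ∷ []) = square-relation z≢0 (tr-bit f) Az
      where
      product : ∀ {a} b → tr a ≡ 0# → tr (a * a * b * z) ≡ 0# → a ⊙ (b * z) ≡ a * b * z
      product {a} b tra h = trans (⊙-tr0 (b * z) tra) (begin
        a * (b * z) + tr (a * a * (b * z))   ≡⟨ cong₂ _+_ (R.*-assoc a b z) (cong tr (R.*-assoc (a * a) b z)) ⟨
        a * b * z + tr (a * a * b * z)       ≡⟨ cong (a * b * z +_) h ⟩
        a * b * z + 0#                       ≡⟨ R.+-identityʳ _ ⟩
        a * b * z                            ∎)
      sum : f ⊙ (c * z + u * z) ≡ u * c * z
      sum = trans (H (u * z) (c * z) (trans (product u trc h₁) (trans (cong (_* z) (R.*-comm c u)) (sym (product c tru h₂)))))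
        (product c tru h₂)
      Az : A * z ≡ tr f * √ ((c + u) * z)
      Az = begin
        A * z                                          ≡⟨ trans (R.distribʳ z _ _) (cong (_+ u * c * z) (R.*-assoc f (c + u) z)) ⟩
        f * ((c + u) * z) + u * c * z                  ≡⟨ solve 3 (λ p q r → p :+ q := p :+ r :+ con false :+ (q :+ r))
                                                            refl (f * ((c + u) * z)) (u * c * z) (tr f * √ ((c + u) * z)) ⟩
        f * ((c + u) * z) + tr f * √ ((c + u) * z) + 0# + (u * c * z + tr f * √ ((c + u) * z))
                                                       ≡⟨ cong (λ t → f * ((c + u) * z) + tr f * √ ((c + u) * z) + t + (u * c * z + tr f * √ ((c + u) * z)))
                                                            (trans (cong tr (sym (R.*-assoc _ _ _))) h₃) ⟨
        f ⊙ ((c + u) * z) + (u * c * z + tr f * √ ((c + u) * z))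
                                                       ≡⟨ cong (_+ (u * c * z + tr f * √ ((c + u) * z))) (trans (cong (f ⊙_) (R.distribʳ z c u)) sum) ⟩
        u * c * z + (u * c * z + tr f * √ ((c + u) * z))
                                                       ≡⟨ solve 2 (λ a b → a :+ (a :+ b) := b) refl (u * c * z) (tr f * √ ((c + u) * z)) ⟩
        tr f * √ ((c + u) * z)                         ∎
    A≡0 : A ≡ 0#
    A≡0 with A ≟ 0#
    ... | yes eq = eq
    ... | no A≢0 = ⊥-elim (z₁≢z₂ (*-cancelˡ (*-nonzero A≢0 A≢0) (trans (key z₁ z₁≢0 k₁) (sym (key z₂ z₂≢0 k₂)))))
    trf≡0 : tr f ≡ 0#
    trf≡0 with *-zero-or {tr f} {c + u} (trans (sym (key z₁ z₁≢0 k₁)) (trans (cong (λ a → a * a * z₁) A≡0)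
        (solve 1 (λ z → con false :* con false :* z := con false) refl z₁)))
    ... | inj₁ eq = eq
    ... | inj₂ eq = ⊥-elim (c+u≢0 eq)

  -- Here the trace terms of the two products differ, which the field value of f cannot absorb:
  -- multiplying the equation for f by c + u leaves c = (c + u) τ with a bit τ, so c or u vanishes.
  harmonicSum-separated : ∀ {c u f w} → c ≢ 0# → u ≢ 0# → tr c ≡ 0# → tr u ≡ 0# → HarmonicSum c u f →
    f * (c + u) ≡ u * c → tr f ≡ 0# → tr (c * w) ≡ 0# → tr (u * w) ≡ 1# → ⊥
  harmonicSum-separated {c} {u} {f} {w} c≢0 u≢0 trc tru H f-value trf cw uw
    with inverse c c≢0 | inverse u u≢0
  ... | c⁻¹ , cc⁻¹≡1 | u⁻¹ , uu⁻¹≡1 = impossible (tr-bit (f * f * (t + s)))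
    where
    open ≡-Reasoning
    s t τ : Carrier
    -- The factors are chosen with c s = 1 + w and u t = w; their trace terms are 0 and 1, so both
    -- products are w + 1.
    s = c⁻¹ * (1# + w)
    t = u⁻¹ * w
    τ = tr (f * f * (t + s))
    cs : c * s ≡ 1# + w
    cs = trans (sym (R.*-assoc _ _ _)) (trans (cong (_* (1# + w)) cc⁻¹≡1) (R.*-identityˡ _))
    ut : u * t ≡ w
    ut = trans (sym (R.*-assoc _ _ _)) (trans (cong (_* w) uu⁻¹≡1) (R.*-identityˡ _))
    u⊙t : u ⊙ t ≡ w + 1#
    u⊙t = trans (⊙-tr0 t tru) (cong₂ _+_ ut (trans (cong tr (trans (R.*-assoc u u t) (cong (u *_) ut))) uw))
    c⊙s : c ⊙ s ≡ w + 1#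
    c⊙s = trans (⊙-tr0 s trc) (begin
      c * s + tr (c * c * s)         ≡⟨ cong₂ _+_ cs (cong tr (trans (R.*-assoc c c s) (cong (c *_) cs))) ⟩
      1# + w + tr (c * (1# + w))     ≡⟨ cong (λ z → 1# + w + tr z) (trans (R.distribˡ c 1# w) (cong (_+ c * w) (R.*-identityʳ c))) ⟩
      1# + w + tr (c + c * w)        ≡⟨ cong (1# + w +_) (trans (tr-+ c (c * w)) (cong₂ _+_ trc cw)) ⟩
      1# + w + (0# + 0#)             ≡⟨ solve 1 (λ w → con true :+ w :+ (con false :+ con false) := w :+ con true) refl w ⟩
      w + 1#                         ∎)
    f-sum : f * (t + s) + τ ≡ w + 1#
    f-sum = trans (sym (⊙-tr0 (t + s) trf)) (trans (H s t (trans c⊙s (sym u⊙t))) u⊙t)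
    c≡ : (c + u) * τ ≡ c
    c≡ = begin
      (c + u) * τ                                        ≡⟨ solve 6 (λ c u f t s τ → (c :+ u) :* τ := (c :+ u) :* (f :* (t :+ s) :+ τ) :+ (f :* (c :+ u)) :* (t :+ s))
                                                              refl c u f t s τ ⟩
      (c + u) * (f * (t + s) + τ) + f * (c + u) * (t + s)
                                                         ≡⟨ cong₂ (λ p q → (c + u) * p + q * (t + s)) f-sum f-value ⟩
      (c + u) * (w + 1#) + u * c * (t + s)               ≡⟨ solve 5 (λ c u w t s → (c :+ u) :* (w :+ con true) :+ u :* c :* (t :+ s)
                                                                := (c :+ u) :* (w :+ con true) :+ (c :* (u :* t) :+ u :* (c :* s))) refl c u w t s ⟩
      (c + u) * (w + 1#) + (c * (u * t) + u * (c * s))   ≡⟨ cong₂ (λ p q → (c + u) * (w + 1#) + (c * p + u * q)) ut cs ⟩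
      (c + u) * (w + 1#) + (c * w + u * (1# + w))        ≡⟨ solve 3 (λ c u w → (c :+ u) :* (w :+ con true) :+ (c :* w :+ u :* (con true :+ w)) := c) refl c u w ⟩
      c                                                  ∎
    impossible : IsBit τ → ⊥
    impossible (inj₁ τ≡0) = c≢0 (trans (sym c≡) (trans (cong ((c + u) *_) τ≡0) (R.zeroʳ _)))
    impossible (inj₂ τ≡1) = u≢0 (P.+-cancelˡ c u 0# (trans (sym (R.*-identityʳ _))
      (trans (cong ((c + u) *_) (sym τ≡1)) (trans c≡ (sym (R.+-identityʳ c))))))

  -- For w = 1/(c + u) the bits Tr (c w) and Tr (u w) add up to Tr 1 = 1, so exactly one is 1, and
  -- `harmonicSum-separated` applies in one of the two orders.
  no-harmonicSums : 4 < n →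
    ¬ (∀ c u → c ≢ 0# → u ≢ 0# → c ≢ u → tr c ≡ 0# → ∃ λ f → HarmonicSum c u f)
  no-harmonicSums 4<n sums with kernel-two (traceOf 1# ∷ []) (ℕ.≤-trans (s≤s (s≤s (s≤s z≤n))) 4<n)
  ... | c , u , c≢0 , u≢0 , c≢u , trc′ ∷ [] , tru′ ∷ [] with sums c u c≢0 u≢0 c≢u (trans (cong tr (sym (R.*-identityˡ c))) trc′)
  ...   | f , H with inverse (c + u) (λ eq → c≢u (x+y≡0⇒x≡y eq))
  ...     | w , [c+u]w≡1 = separate (tr-bit (c * w)) (tr-bit (u * w))
    where
    trc : tr c ≡ 0#
    trc = trans (cong tr (sym (R.*-identityˡ c))) trc′
    tru : tr u ≡ 0#
    tru = trans (cong tr (sym (R.*-identityˡ u))) tru′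
    value : f * (c + u) ≡ u * c × tr f ≡ 0#
    value = harmonicSum-value 4<n trc tru (λ eq → c≢u (x+y≡0⇒x≡y eq)) H
    sum≡1 : tr (c * w) + tr (u * w) ≡ 1#
    sum≡1 = trans (sym (tr-+ _ _)) (trans (cong tr (trans (sym (R.distribʳ w c u)) [c+u]w≡1)) tr-1)
    equal : tr (c * w) ≡ tr (u * w) → ⊥
    equal eq = 0≢1 (trans (sym (x+x≡0 _)) (trans (cong (_+ tr (u * w)) (sym eq)) sum≡1))
    separate : IsBit (tr (c * w)) → IsBit (tr (u * w)) → ⊥
    separate (inj₁ p) (inj₁ q) = equal (trans p (sym q))
    separate (inj₂ p) (inj₂ q) = equal (trans p (sym q))
    separate (inj₁ p) (inj₂ q) = harmonicSum-separated c≢0 u≢0 trc tru H (proj₁ value) (proj₂ value) p q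
    separate (inj₂ p) (inj₁ q) = harmonicSum-separated u≢0 c≢0 tru trc (harmonicSum-sym H)
      (trans (cong (f *_) (R.+-comm u c)) (trans (proj₁ value) (R.*-comm u c))) (proj₂ value) q p

  -- Taking b = 1/x with Tr x = 0, generic arguments force the field value c = b/(1 + b), while the
  -- argument x itself forces c to be a bit; the two are incompatible.
  no-quotients : 4 < n → ¬ (∀ b → b ≢ 1# → ∃ λ c → ∀ x → (x + x ⊙ b) ⊙ c ≡ x ⊙ b)
  no-quotients 4<n quotients with kernel-nontrivial (traceOf 1# ∷ []) (ℕ.≤-trans (s≤s (s≤s z≤n)) 4<n)
  ... | x , x≢0 , trx′ ∷ [] with inverse x x≢0
  ...   | b , xb≡1 = contradict (quotients b b≢1)
    where
    open ≡-Reasoning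
    trx : tr x ≡ 0#
    trx = trans (cong tr (sym (R.*-identityˡ x))) trx′
    b≢1 : b ≢ 1#
    b≢1 b≡1 = 0≢1 (trans (sym trx) (trans (cong tr (trans (sym (R.*-identityʳ x)) (trans (cong (x *_) (sym b≡1)) xb≡1))) tr-1))
    b≢0 : b ≢ 0#
    b≢0 b≡0 = 0≢1 (trans (sym (R.zeroʳ x)) (trans (cong (x *_) (sym b≡0)) xb≡1))
    x⊙b : x ⊙ b ≡ 1#
    x⊙b = begin
      x ⊙ b                   ≡⟨ ⊙-tr0 b trx ⟩
      x * b + tr (x * x * b)  ≡⟨ cong₂ (λ p q → p + tr q) xb≡1 (trans (R.*-assoc x x b) (trans (cong (x *_) xb≡1) (R.*-identityʳ x))) ⟩
      1# + tr x               ≡⟨ cong (1# +_) trx ⟩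
      1# + 0#                 ≡⟨ R.+-identityʳ 1# ⟩
      1#                      ∎
    contradict : (∃ λ c → ∀ x → (x + x ⊙ b) ⊙ c ≡ x ⊙ b) → ⊥
    contradict (c , c-quotient) = c≢bit (subst IsBit (√-square c) (subst IsBit (sym (bit-idempotent √c-bit)) √c-bit))
      where
      -- This vanishes exactly when c (1 + b) = b. In the kernel below all products become field
      -- products, apart from one remaining bit T.
      w : Carrier
      w = c + b * c + b
      multiple-bit : ∀ z → Kernel (traceOf 1# ∷ traceOf b ∷ traceOfSquare b ∷ []) z → IsBit (w * z)
      multiple-bit z (h₁ ∷ h₂ ∷ h₃ ∷ []) = subst IsBit (sym wz) (tr-bit _)
        where
        trz : tr z ≡ 0#
        trz = trans (cong tr (sym (R.*-identityˡ z))) h₁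
        z⊙b : z ⊙ b ≡ b * z
        z⊙b = trans (⊙-tr0 b trz) (trans (cong (z * b +_) h₃) (trans (R.+-identityʳ _) (R.*-comm z b)))
        tr-sum : tr (z + b * z) ≡ 0#
        tr-sum = trans (tr-+ _ _) (trans (cong₂ _+_ trz h₂) (R.+-identityʳ 0#))
        T : Carrier
        T = tr ((z + b * z) * (z + b * z) * c)
        q : (z + b * z) * c + T ≡ b * z
        q = trans (sym (⊙-tr0 c tr-sum)) (trans (cong (λ y → (z + y) ⊙ c) (sym z⊙b)) (trans (c-quotient z) z⊙b))
        wz : w * z ≡ T
        wz = begin
          w * z                               ≡⟨ solve 4 (λ b c z t → (c :+ b :* c :+ b) :* z := ((z :+ b :* z) :* c :+ t) :+ (t :+ b :* z)) refl b c z T ⟩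
          ((z + b * z) * c + T) + (T + b * z) ≡⟨ cong (_+ (T + b * z)) q ⟩
          b * z + (T + b * z)                 ≡⟨ solve 2 (λ p t → p :+ (t :+ p) := t) refl _ _ ⟩
          T                                   ∎
      w≡0 : w ≡ 0#
      w≡0 with kernel-two (traceOf 1# ∷ traceOf b ∷ traceOfSquare b ∷ []) 4<n
      ... | y , z , y≢0 , z≢0 , y≢z , ky , kz = bit-multiples⇒0 y≢0 z≢0 y≢z (multiple-bit y ky) (multiple-bit z kz)
      M : Carrier
      M = tr ((x + 1#) * (x + 1#) * c)
      -- Since x ⊙ b = 1, the left factor is x + 1, of trace 1, so the root term survives; w = 0
      -- gives (x + 1) c = 1, leaving √c = M.
      at-x : (x + 1#) * c + √ c + M ≡ 1#
      at-x = begin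
        (x + 1#) * c + √ c + M    ≡⟨ ⊙-tr1 c (trans (tr-+ x 1#) (trans (cong₂ _+_ trx tr-1) (R.+-identityˡ 1#))) ⟨
        (x + 1#) ⊙ c              ≡⟨ cong (λ y → (x + y) ⊙ c) x⊙b ⟨
        (x + x ⊙ b) ⊙ c           ≡⟨ c-quotient x ⟩
        x ⊙ b                     ≡⟨ x⊙b ⟩
        1#                        ∎
      √c-bit : IsBit (√ c)
      √c-bit = subst IsBit (sym (begin
        √ c                                                ≡⟨ solve 5 (λ b c x s m → s := m :+ ((x :+ con true) :* c :+ s :+ m) :+ ((c :+ b :* c :+ b) :* x :+ c :* (x :* b :+ con true) :+ x :* b))
                                                               refl b c x (√ c) M ⟩
        M + ((x + 1#) * c + √ c + M) + (w * x + c * (x * b + 1#) + x * b)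
                                                           ≡⟨ cong₂ (λ p q → M + p + q) at-x (cong₂ (λ p q → p * x + c * (q + 1#) + q) w≡0 xb≡1) ⟩
        M + 1# + (0# * x + c * (1# + 1#) + 1#)             ≡⟨ solve 3 (λ m x c → m :+ con true :+ (con false :* x :+ c :* (con true :+ con true) :+ con true) := m) refl M x c ⟩
        M                                                  ∎)) (tr-bit _)
      c≢bit : IsBit c → ⊥
      c≢bit (inj₁ c≡0) = b≢0 (trans (solve 1 (λ b → b := con false :+ b :* con false :+ b) refl b)
        (trans (cong (λ z → z + b * z + b) (sym c≡0)) w≡0))
      c≢bit (inj₂ c≡1) = 0≢1 (sym (trans (solve 1 (λ b → con true := con true :+ b :* con true :+ b) refl b)
        (trans (cong (λ z → z + b * z + b) (sym c≡1)) w≡0)))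

-- Rigidity of autotopisms that intertwine Frobenius powers.

module Autotopism {n : ℕ} (n-odd : n % 2 ≡ 1) (F : FiniteField2^ n) where
  open FiniteField2^ F
  open Arithmetic F
  open Trace n-odd F
  open Presemifield n-odd F
  open Functional
  open Char2Solver using (solve; _:=_; _:+_; _:*_)

  -- The form takes the same value on all n conjugates of x, and n is odd, so λ′ (Tr x) = λ′ x; and
  -- λ′ fixes the bit Tr x.
  invariant-functional≡tr : ∀ λ′ → Additive λ′ → (∀ x → λ′ (x * x) ≡ λ′ x) → λ′ 1# ≡ 1# → ∀ x → λ′ x ≡ tr x
  invariant-functional≡tr λ′ add inv λ′1 x = trans (sym (on-trSum n n-odd)) (on-bit (tr-bit x))
    where
    on-frob : ∀ k → λ′ (frob k x) ≡ λ′ x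
    on-frob ℕ.zero = refl
    on-frob (ℕ.suc k) = trans (inv (frob k x)) (on-frob k)
    on-trSum : ∀ m → m % 2 ≡ 1 → λ′ (trSum F m x) ≡ λ′ x
    on-trSum 1 _ = cong λ′ (R.+-identityˡ x)
    on-trSum (ℕ.suc (ℕ.suc m)) odd = begin
      λ′ (trSum F m x + frob m x + frob (ℕ.suc m) x)            ≡⟨ trans (add _ _) (cong₂ _+_ (add _ _) refl) ⟩
      λ′ (trSum F m x) + λ′ (frob m x) + λ′ (frob (ℕ.suc m) x)  ≡⟨ cong (λ′ (trSum F m x) + λ′ (frob m x) +_) (inv (frob m x)) ⟩
      λ′ (trSum F m x) + λ′ (frob m x) + λ′ (frob m x)          ≡⟨ solve 2 (λ a b → a :+ b :+ b := a) refl _ _ ⟩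
      λ′ (trSum F m x)                                          ≡⟨ on-trSum m odd ⟩
      λ′ x                                                      ∎
      where open ≡-Reasoning
    on-bit : ∀ {t} → IsBit t → λ′ t ≡ t
    on-bit (inj₁ refl) = additive-0 add
    on-bit (inj₂ refl) = λ′1

  -- The condition on `e` is phrased through the fixed points of `frob e` because the module serves
  -- both for e and for the representative (n - 1) e of -e.
  module Rigidity (4<n : 4 < n) {d e : ℕ} (d-coprime : gcd n d ≡ 1) (e-fixed : ∀ x → frob e x ≡ x → IsBit x)
    (β γ : Carrier → Carrier) (β-+ : Additive β) (β-kernel : ∀ x → β x ≡ 0# → x ≡ 0#)
    (β-⊙ : ∀ x a → β (x ⊙ a) ≡ β x ⊙ γ a) (β-frob : ∀ x → β (frob d x) ≡ frob e (β x)) where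
    open ≡-Reasoning

    β-injective : ∀ {x y} → β x ≡ β y → x ≡ y
    β-injective {x} {y} eq = x+y≡0⇒x≡y (β-kernel _ (trans (β-+ x y) (trans (cong (_+ β y) eq) (x+x≡0 _))))

    -- As 1 is fixed by `frob d`, its image is fixed by `frob e`, hence a bit, and it is not 0.
    β-1 : β 1# ≡ 1#
    β-1 with e-fixed (β 1#) (trans (sym (β-frob 1#)) (cong β (frob-1 d)))
    ... | inj₁ eq = ⊥-elim (0≢1 (sym (β-kernel 1# eq)))
    ... | inj₂ eq = eq

    β-bit : ∀ {t} → IsBit t → β t ≡ t
    β-bit (inj₁ refl) = additive-0 β-+
    β-bit (inj₂ refl) = β-1

    -- The form x ↦ Tr (β x) is invariant under `frob d`, hence under squaring since d is prime to
    -- n; the trace is the only such form with value 1 at 1.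
    tr-β : ∀ x → tr (β x) ≡ tr x
    tr-β = invariant-functional≡tr (λ x → tr (β x)) (λ x y → trans (cong tr (β-+ x y)) (tr-+ _ _))
      (frob-invariant d d-coprime (λ x → tr (β x)) (λ x → trans (cong tr (β-frob x)) (tr-frob e (β x))))
      (trans (cong tr β-1) tr-1)

    -- The sum of the last trace terms of x ⊙ a and of β x ⊙ γ a: the error made when `β-⊙` is read
    -- with field products.
    ε : Carrier → Functional
    ε a = record
      { fun = λ x → tr (x * x * a) + tr (β x * β x * γ a)
      ; additive = λ x y → trans
          (cong₂ _+_ (additive (traceOfSquare a) x y)
            (trans (cong (λ z → tr (z * z * γ a)) (β-+ x y)) (additive (traceOfSquare (γ a)) (β x) (β y))))
          (solve 4 (λ p q r s → (p :+ q) :+ (r :+ s) := (p :+ r) :+ (q :+ s)) refl _ _ _ _)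
      ; bit = λ x → bit-+ (tr-bit _) (tr-bit _) }

    -- On the trace-zero hyperplane β and γ are multiplicative up to an error in F₂.
    β-* : ∀ x a → tr x ≡ 0# → β (x * a) ≡ β x * γ a + fun (ε a) x
    β-* x a trx = begin
      β (x * a)                            ≡⟨ solve 2 (λ p t → p := (p :+ t) :+ t) refl (β (x * a)) t ⟩
      (β (x * a) + t) + t                  ≡⟨ cong (λ z → (β (x * a) + z) + t) (β-bit (tr-bit _)) ⟨
      (β (x * a) + β t) + t                ≡⟨ cong (_+ t) (β-+ _ _) ⟨
      β (x * a + t) + t                    ≡⟨ cong (λ z → β z + t) (⊙-tr0 a trx) ⟨
      β (x ⊙ a) + t                        ≡⟨ cong (_+ t) (trans (β-⊙ x a) (⊙-tr0 (γ a) (trans (tr-β x) trx))) ⟩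
      (β x * γ a + t′) + t                 ≡⟨ solve 3 (λ p q r → (p :+ q) :+ r := p :+ (r :+ q)) refl _ _ _ ⟩
      β x * γ a + (t + t′)                 ∎
      where
      t t′ : Carrier
      t = tr (x * x * a)
      t′ = tr (β x * β x * γ a)

    tr-traceOf-1 : ∀ {x} → fun (traceOf 1#) x ≡ 0# → tr x ≡ 0#
    tr-traceOf-1 {x} h = trans (cong tr (sym (R.*-identityˡ x))) h

    -- For z of trace zero, β ((z a)^(2^d)) can be expanded before or after applying the Frobenius
    -- power. The two results differ by a bit, and two values of z make the comparison exact.
    γ-frob : ∀ a → γ (frob d a) ≡ frob e (γ a)
    γ-frob a with kernel-two (traceOf 1# ∷ []) (ℕ.≤-trans (s≤s (s≤s (s≤s z≤n))) 4<n)
    ... | x , y , x≢0 , y≢0 , x≢y , trx ∷ [] , try ∷ [] = x+y≡0⇒x≡y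
        (bit-multiples⇒0 (nonzero x≢0) (nonzero y≢0) distinct (multiple-bit x (tr-traceOf-1 trx)) (multiple-bit y (tr-traceOf-1 try)))
      where
      nonzero : ∀ {z} → z ≢ 0# → frob e (β z) ≢ 0#
      nonzero z≢0 = frob-nonzero e (λ eq → z≢0 (β-kernel _ eq))
      distinct : frob e (β x) ≢ frob e (β y)
      distinct eq = frob-nonzero e {β x + β y} (λ sum≡0 → x≢y (β-injective (x+y≡0⇒x≡y sum≡0)))
        (trans (frob-+ e (β x) (β y)) (trans (cong (_+ frob e (β y)) eq) (x+x≡0 _)))
      multiple-bit : ∀ z → tr z ≡ 0# → IsBit ((γ (frob d a) + frob e (γ a)) * frob e (β z))
      multiple-bit z trz = subst IsBit (sym (begin
        (γ (frob d a) + frob e (γ a)) * G     ≡⟨ solve 5 (λ p q g s t → (p :+ q) :* g := (g :* p :+ s) :+ (g :* q :+ t) :+ (s :+ t)) refl _ _ _ s t ⟩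
        (G * γ (frob d a) + s) + (G * frob e (γ a) + t) + (s + t)
                                              ≡⟨ cong (λ y → y + (G * frob e (γ a) + t) + (s + t)) left ⟩
        (G * frob e (γ a) + t) + (G * frob e (γ a) + t) + (s + t)
                                              ≡⟨ trans (cong (_+ (s + t)) (x+x≡0 _)) (R.+-identityˡ _) ⟩
        s + t                                 ∎)) (bit-+ (bit (ε (frob d a)) _) (bit (ε a) z))
        where
        G s t : Carrier
        G = frob e (β z)
        s = fun (ε (frob d a)) (frob d z)
        t = fun (ε a) z
        left : G * γ (frob d a) + s ≡ G * frob e (γ a) + t
        left = begin
          G * γ (frob d a) + s                      ≡⟨ cong (λ y → y * γ (frob d a) + s) (β-frob z) ⟨
          β (frob d z) * γ (frob d a) + s           ≡⟨ β-* (frob d z) (frob d a) (trans (tr-frob d z) trz) ⟨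
          β (frob d z * frob d a)                   ≡⟨ cong β (frob-* d z a) ⟨
          β (frob d (z * a))                        ≡⟨ β-frob (z * a) ⟩
          frob e (β (z * a))                        ≡⟨ cong (frob e) (β-* z a trz) ⟩
          frob e (β z * γ a + t)                    ≡⟨ frob-+ e _ _ ⟩
          frob e (β z * γ a) + frob e t             ≡⟨ cong₂ _+_ (frob-* e (β z) (γ a)) (frob-bit e (bit (ε a) z)) ⟩
          G * frob e (γ a) + t                      ∎

    -- Compare (xa)b with x(ab) for x in the hyperplane with xa in it too.
    γ-* : ∀ a b → γ (a * b) ≡ γ a * γ b
    γ-* a b with kernel-two (traceOf 1# ∷ traceOf a ∷ ε a ∷ []) 4<n
    ... | x , y , x≢0 , y≢0 , x≢y , kx , ky = x+y≡0⇒x≡y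
        (bit-multiples⇒0 (λ eq → x≢0 (β-kernel _ eq)) (λ eq → y≢0 (β-kernel _ eq)) (λ eq → x≢y (β-injective eq))
          (multiple-bit x kx) (multiple-bit y ky))
      where
      multiple-bit : ∀ z → Kernel (traceOf 1# ∷ traceOf a ∷ ε a ∷ []) z → IsBit ((γ (a * b) + γ a * γ b) * β z)
      multiple-bit z (trz ∷ traz ∷ εz ∷ []) = subst IsBit (sym (begin
        (γ (a * b) + γ a * γ b) * β z         ≡⟨ solve 6 (λ p q r g s t → (p :+ q :* r) :* g := (g :* p :+ s) :+ (g :* q :* r :+ t) :+ (s :+ t)) refl _ _ _ _ s t ⟩
        (β z * γ (a * b) + s) + (β z * γ a * γ b + t) + (s + t)
                                              ≡⟨ cong (λ y → y + (β z * γ a * γ b + t) + (s + t)) associate ⟩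
        (β z * γ a * γ b + t) + (β z * γ a * γ b + t) + (s + t)
                                              ≡⟨ trans (cong (_+ (s + t)) (x+x≡0 _)) (R.+-identityˡ _) ⟩
        s + t                                 ∎)) (bit-+ (bit (ε (a * b)) z) (bit (ε b) (z * a)))
        where
        s t : Carrier
        s = fun (ε (a * b)) z
        t = fun (ε b) (z * a)
        associate : β z * γ (a * b) + s ≡ β z * γ a * γ b + t
        associate = begin
          β z * γ (a * b) + s      ≡⟨ β-* z (a * b) (tr-traceOf-1 trz) ⟨
          β (z * (a * b))          ≡⟨ cong β (R.*-assoc z a b) ⟨
          β (z * a * b)            ≡⟨ β-* (z * a) b (trans (cong tr (R.*-comm z a)) traz) ⟩
          β (z * a) * γ b + t      ≡⟨ cong (λ y → y * γ b + t) (trans (β-* z a (tr-traceOf-1 trz)) (trans (cong (β z * γ a +_) εz) (R.+-identityʳ _))) ⟩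
          β z * γ a * γ b + t      ∎

    frob-γ : ∀ k a → γ (frob k a) ≡ frob k (γ a)
    frob-γ ℕ.zero a = refl
    frob-γ (ℕ.suc k) a = trans (γ-* _ _) (cong (λ z → z * z) (frob-γ k a))

    -- Being multiplicative, γ commutes with `frob d`, while `γ-frob` turns `frob d` into `frob e`;
    -- the two powers therefore agree on the image of γ.
    frob-d≡frob-e : (∀ y → ∃ λ a → γ a ≡ y) → ∀ y → frob d y ≡ frob e y
    frob-d≡frob-e γ-surjective y = case γ-surjective y of λ
      { (a , refl) → trans (sym (frob-γ d a)) (γ-frob a) }

-- Collineations: the line at infinity and (∞) are fixed.

module Plane {n : ℕ} (n-odd : n % 2 ≡ 1) (F : FiniteField2^ n) where
  open FiniteField2^ F
  open Arithmetic F
  open Trace n-odd F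
  open Presemifield n-odd F
  open Char2Solver using (solve; _:=_; _:+_)

  infix 4 _on_
  _on_ : Point F → Line F → Set
  _on_ = _I_ F

  -- Collineations with their inverses as data, so that composites and conjugates have computable
  -- point and line maps.
  record Automorphism : Set where
    field
      pt pt⁻ : Point F → Point F
      ln ln⁻ : Line F → Line F
      pt-pt⁻ : ∀ P → pt (pt⁻ P) ≡ P
      pt⁻-pt : ∀ P → pt⁻ (pt P) ≡ P
      ln-ln⁻ : ∀ L → ln (ln⁻ L) ≡ L
      ln⁻-ln : ∀ L → ln⁻ (ln L) ≡ L
      preserve : ∀ {P L} → P on L → pt P on ln L
      reflect  : ∀ {P L} → pt P on ln L → P on L

    pt-injective : ∀ {P Q} → pt P ≡ pt Q → P ≡ Q
    pt-injective eq = trans (sym (pt⁻-pt _)) (trans (cong pt⁻ eq) (pt⁻-pt _))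

    ln-injective : ∀ {K L} → ln K ≡ ln L → K ≡ L
    ln-injective eq = trans (sym (ln⁻-ln _)) (trans (cong ln⁻ eq) (ln⁻-ln _))

  open Automorphism

  inverseAut : Automorphism → Automorphism
  inverseAut φ = record
    { pt = pt⁻ φ ; pt⁻ = pt φ ; ln = ln⁻ φ ; ln⁻ = ln φ
    ; pt-pt⁻ = pt⁻-pt φ ; pt⁻-pt = pt-pt⁻ φ ; ln-ln⁻ = ln⁻-ln φ ; ln⁻-ln = ln-ln⁻ φ
    ; preserve = λ {P} {L} P∈L → reflect φ (subst (_on _) (sym (pt-pt⁻ φ P)) (subst (P on_) (sym (ln-ln⁻ φ L)) P∈L))
    ; reflect = λ {P} {L} P∈L → subst (_on L) (pt-pt⁻ φ P) (subst (_ on_) (ln-ln⁻ φ L) (preserve φ P∈L)) }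

  infixr 9 _⨾_
  _⨾_ : Automorphism → Automorphism → Automorphism
  φ ⨾ ψ = record
    { pt = λ P → pt ψ (pt φ P) ; pt⁻ = λ P → pt⁻ φ (pt⁻ ψ P)
    ; ln = λ L → ln ψ (ln φ L) ; ln⁻ = λ L → ln⁻ φ (ln⁻ ψ L)
    ; pt-pt⁻ = λ P → trans (cong (pt ψ) (pt-pt⁻ φ _)) (pt-pt⁻ ψ P)
    ; pt⁻-pt = λ P → trans (cong (pt⁻ φ) (pt⁻-pt ψ _)) (pt⁻-pt φ P)
    ; ln-ln⁻ = λ L → trans (cong (ln ψ) (ln-ln⁻ φ _)) (ln-ln⁻ ψ L)
    ; ln⁻-ln = λ L → trans (cong (ln⁻ φ) (ln⁻-ln ψ _)) (ln⁻-ln φ L)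
    ; preserve = λ P∈L → preserve ψ (preserve φ P∈L)
    ; reflect = λ P∈L → reflect φ (reflect ψ P∈L) }

  map-on : ∀ φ {P Q L M} → pt φ P ≡ Q → ln φ L ≡ M → P on L → Q on M
  map-on φ refl refl P∈L = preserve φ P∈L

  preimage-on : ∀ φ {P L M} → ln φ L ≡ M → P on M → pt⁻ φ P on L
  preimage-on φ {P} {L} φL P∈ = reflect φ (subst (_on ln φ L) (sym (pt-pt⁻ φ P)) (subst (P on_) (sym φL) P∈))

  -- Translations and shears are their own inverses in characteristic 2, so reflecting incidence is
  -- preserving it a second time.
  involution : (f : Point F → Point F) (g : Line F → Line F) →
    (∀ P → f (f P) ≡ P) → (∀ L → g (g L) ≡ L) → (∀ P L → P on L → f P on g L) → Automorphism
  involution f g ff gg pres = record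
    { pt = f ; pt⁻ = f ; ln = g ; ln⁻ = g
    ; pt-pt⁻ = ff ; pt⁻-pt = ff ; ln-ln⁻ = gg ; ln⁻-ln = gg
    ; preserve = λ {P} {L} → pres P L
    ; reflect = λ {P} {L} fP∈gL → subst (_on L) (ff P) (subst (_ on_) (gg L) (pres (f P) (g L) fP∈gL)) }

  toCollineation : Automorphism → Collineation F
  toCollineation φ = record
    { onPoints = mk⤖ (pt-injective φ , λ P → pt⁻ φ P , λ { refl → pt-pt⁻ φ P })
    ; onLines = mk⤖ (ln-injective φ , λ L → ln⁻ φ L , λ { refl → ln-ln⁻ φ L })
    ; preserves = λ P L → preserve φ , reflect φ }

  fromCollineation : Collineation F → Automorphism
  fromCollineation c = record
    { pt = Inverse.to P↔ ; pt⁻ = Inverse.from P↔ ; ln = Inverse.to L↔ ; ln⁻ = Inverse.from L↔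
    ; pt-pt⁻ = Inverse.strictlyInverseˡ P↔ ; pt⁻-pt = Inverse.strictlyInverseʳ P↔
    ; ln-ln⁻ = Inverse.strictlyInverseˡ L↔ ; ln⁻-ln = Inverse.strictlyInverseʳ L↔
    ; preserve = λ {P} {L} → proj₁ (Collineation.preserves c P L)
    ; reflect = λ {P} {L} → proj₂ (Collineation.preserves c P L) }
    where
    P↔ = ⤖⇒↔ (Collineation.onPoints c)
    L↔ = ⤖⇒↔ (Collineation.onLines c)

  x+y+y≡x : ∀ x y → x + y + y ≡ x
  x+y+y≡x = solve 2 (λ x y → x :+ y :+ y := x) refl

  x+[x+y]≡y : ∀ x y → x + (x + y) ≡ y
  x+[x+y]≡y = solve 2 (λ x y → x :+ (x :+ y) := y) refl

  translation : Carrier → Carrier → Automorphism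
  translation v w = involution f g ff gg pres
    where
    f : Point F → Point F
    f (aff x y) = aff (x + v) (y + w)
    f (inf s)   = inf s
    g : Line F → Line F
    g lineInf   = lineInf
    g (vert a)  = vert (a + v)
    g (lin a b) = lin a (b + (w + v ⊙ a))
    ff : ∀ P → f (f P) ≡ P
    ff (aff x y) = cong₂ aff (x+y+y≡x x v) (x+y+y≡x y w)
    ff (inf s)   = refl
    gg : ∀ L → g (g L) ≡ L
    gg lineInf   = refl
    gg (vert a)  = cong vert (x+y+y≡x a v)
    gg (lin a b) = cong (lin a) (x+y+y≡x b _)
    pres : ∀ P L → P on L → f P on g L
    pres (aff x y) (vert a) x≡a = cong (_+ v) x≡a
    pres (aff x y) (lin a b) y≡ = trans (cong (_+ w) y≡) (trans
      (solve 4 (λ p b w q → p :+ b :+ w := (p :+ q) :+ (b :+ (w :+ q))) refl (x ⊙ a) b w (v ⊙ a))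
      (cong (_+ (b + (w + v ⊙ a))) (sym (⊙-distribʳ a x v))))
    pres (inf s) lineInf _ = tt
    pres (inf nothing) (vert a) _ = tt
    pres (inf (just c)) (lin a b) c≡a = c≡a

  shear : Carrier → Automorphism
  shear t = involution f g ff gg pres
    where
    f : Point F → Point F
    f (aff x y)      = aff x (y + x ⊙ t)
    f (inf nothing)  = inf nothing
    f (inf (just a)) = inf (just (a + t))
    g : Line F → Line F
    g lineInf   = lineInf
    g (vert a)  = vert a
    g (lin a b) = lin (a + t) b
    ff : ∀ P → f (f P) ≡ P
    ff (aff x y)      = cong (aff x) (x+y+y≡x y (x ⊙ t))
    ff (inf nothing)  = refl
    ff (inf (just a)) = cong (λ s → inf (just s)) (x+y+y≡x a t)
    gg : ∀ L → g (g L) ≡ L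
    gg lineInf   = refl
    gg (vert a)  = refl
    gg (lin a b) = cong (λ s → lin s b) (x+y+y≡x a t)
    pres : ∀ P L → P on L → f P on g L
    pres (aff x y) (vert a) x≡a = x≡a
    pres (aff x y) (lin a b) y≡ = trans (cong (_+ x ⊙ t) y≡) (trans
      (solve 3 (λ p b q → p :+ b :+ q := (p :+ q) :+ b) refl (x ⊙ a) b (x ⊙ t))
      (cong (_+ b) (sym (⊙-distribˡ x a t))))
    pres (inf nothing) lineInf _ = tt
    pres (inf (just c)) lineInf _ = tt
    pres (inf nothing) (vert a) _ = tt
    pres (inf (just c)) (lin a b) c≡a = cong (_+ t) c≡a

  origin : Point F
  origin = aff 0# 0#

  ∞ : Point F
  ∞ = inf nothing

  slope : Carrier → Point F
  slope a = inf (just a)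

  on-lineInf : ∀ {P} → P on lineInf → ∃ λ s → P ≡ inf s
  on-lineInf {inf s} _ = s , refl

  off-lineInf : ∀ {P} → ¬ (P on lineInf) → ∃ λ x → ∃ λ y → P ≡ aff x y
  off-lineInf {aff x y} _ = x , y , refl
  off-lineInf {inf s} off = ⊥-elim (off tt)

  joins-∞-affine : ∀ {L x y} → ∞ on L → aff x y on L → L ≡ vert x
  joins-∞-affine {vert a} _ x≡a = cong vert (sym x≡a)
  joins-∞-affine {lineInf} _ ()

  joins-∞-slope : ∀ {L a} → ∞ on L → slope a on L → L ≡ lineInf
  joins-∞-slope {lineInf} _ _ = refl

  joins-slope-affine : ∀ {L a x y b} → slope a on L → aff x y on L → y ≡ x ⊙ a + b → L ≡ lin a b
  joins-slope-affine {lineInf} _ () _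
  joins-slope-affine {lin a b} refl y≡ y≡′ = cong (lin a) (P.+-cancelˡ _ _ _ (trans (sym y≡) y≡′))

  joins-slope-y-axis : ∀ {L a b} → slope a on L → aff 0# b on L → L ≡ lin a b
  joins-slope-y-axis {L} {a} {b} s p = joins-slope-affine s p (sym (trans (cong (_+ b) (⊙-zeroˡ a)) (R.+-identityˡ b)))

  through-origin : ∀ {L} → origin on L → L ≡ vert 0# ⊎ ∃ λ a → L ≡ lin a 0#
  through-origin {vert a} 0≡a = inj₁ (cong vert (sym 0≡a))
  through-origin {lin a b} 0≡ = inj₂ (a , cong (lin a)
    (sym (trans 0≡ (trans (cong (_+ b) (⊙-zeroˡ a)) (R.+-identityˡ b)))))

  meet-vert-lin : ∀ {P c a b} → P on vert c → P on lin a b → P ≡ aff c (c ⊙ a + b)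
  meet-vert-lin {aff x y} refl y≡ = cong (aff x) y≡
  meet-vert-lin {inf nothing} _ ()

  joins-y-axis-affine : ∀ {L b c y} → c ≢ 0# → aff 0# b on L → aff c y on L →
    ∃ λ a → L ≡ lin a b × y ≡ c ⊙ a + b
  joins-y-axis-affine {vert a} c≢0 0≡a c≡a = ⊥-elim (c≢0 (trans c≡a (sym 0≡a)))
  joins-y-axis-affine {lin a b′} {b} {c} c≢0 b≡ y≡ = a , cong (lin a) b′≡b , trans y≡ (cong (c ⊙ a +_) b′≡b)
    where
    b′≡b : b′ ≡ b
    b′≡b = sym (trans b≡ (trans (cong (_+ b′) (⊙-zeroˡ a)) (R.+-identityˡ b′)))

  -- The sum of two affine points of N is a vector along N, so the translation by it fixes every
  -- line parallel to N.
  translation-direction : ∀ s N {p₁ p₂ q₁ q₂} → inf s on N → aff p₁ p₂ on N → aff q₁ q₂ on N →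
    ∀ M → inf s on M → ln (translation (p₁ + q₁) (p₂ + q₂)) M ≡ M
  translation-direction s N sN pN qN lineInf sM = refl
  translation-direction nothing (vert a) {p₁} {q₁ = q₁} sN p≡a q≡a (vert b) sM = cong vert
    (trans (cong (b +_) (trans (cong₂ _+_ p≡a q≡a) (x+x≡0 a))) (R.+-identityʳ b))
  translation-direction (just a) (lin _ b) {p₁} {p₂} {q₁} {q₂} refl p≡ q≡ (lin _ b′) refl = cong (lin a) (begin
    b′ + (p₂ + q₂ + (p₁ + q₁) ⊙ a)                           ≡⟨ cong₂ (λ y z → b′ + (y + z)) (cong₂ _+_ p≡ q≡) (⊙-distribʳ a p₁ q₁) ⟩
    b′ + (p₁ ⊙ a + b + (q₁ ⊙ a + b) + (p₁ ⊙ a + q₁ ⊙ a))     ≡⟨ solve 4 (λ b′ p b q → b′ :+ (p :+ b :+ (q :+ b) :+ (p :+ q)) := b′) refl b′ _ b _ ⟩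
    b′                                                       ∎)
    where open ≡-Reasoning

  -- The swapped points lie on the x-axis, a line through the centre; prescribing them fixes which
  -- elation is meant.
  record ElationSwapping (c : Carrier) : Set where
    field
      σ       : Automorphism
      axis    : ∀ {P} → P on vert 0# → pt σ P ≡ P
      centre  : ∀ {L} → origin on L → ln σ L ≡ L
      slope0↦ : pt σ (slope 0#) ≡ aff c 0#
      ↦slope0 : pt σ (aff c 0#) ≡ slope 0#

  on-x-axis : ∀ x → aff x 0# on lin 0# 0#
  on-x-axis x = sym (trans (R.+-identityʳ _) (⊙-zeroʳ x))

  origin-on-lin : ∀ a → origin on lin a 0#
  origin-on-lin a = sym (trans (R.+-identityʳ _) (⊙-zeroˡ a))

  on-horizontal : ∀ x y → aff x y on lin 0# y
  on-horizontal x y = sym (trans (cong (_+ y) (⊙-zeroʳ x)) (R.+-identityˡ y))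

  on-product : ∀ x a → aff x (x ⊙ a) on lin a 0#
  on-product x a = sym (R.+-identityʳ _)

  -- If φ moves the line at infinity to the y-axis, it conjugates translations to elations with axis x = 0.
  conjugate-translation : ∀ φ → ln φ lineInf ≡ vert 0# → ∀ c → c ≢ 0# → ElationSwapping c
  conjugate-translation φ φℓ c c≢0
    with on-lineInf (preimage-on φ {origin} φℓ refl) | off-axis (slope 0#) (λ ()) | off-axis (aff c 0#) c≢0
    where
    off-axis : ∀ P → ¬ (P on vert 0#) → ∃ λ x → ∃ λ y → pt⁻ φ P ≡ aff x y
    off-axis P P∉ = off-lineInf λ P∈ → P∉ (map-on φ {pt⁻ φ P} (pt-pt⁻ φ P) φℓ P∈)
  ... | s , centre≡ | p₁ , p₂ , p≡ | q₁ , q₂ , q≡ = record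
    { σ = inverseAut φ ⨾ τ ⨾ φ
    ; axis = λ {P} → σ-axis P
    ; centre = λ {L} → σ-centre L
    ; slope0↦ = trans (cong (λ Q → pt φ (pt τ Q)) p≡)
        (trans (cong (pt φ) (trans (cong₂ aff (x+[x+y]≡y p₁ q₁) (x+[x+y]≡y p₂ q₂)) (sym q≡))) (pt-pt⁻ φ (aff c 0#)))
    ; ↦slope0 = trans (cong (λ Q → pt φ (pt τ Q)) q≡)
        (trans (cong (pt φ) (trans (cong₂ aff (back p₁ q₁) (back p₂ q₂)) (sym p≡))) (pt-pt⁻ φ (slope 0#))) }
    where
    τ : Automorphism
    τ = translation (p₁ + q₁) (p₂ + q₂)
    back : ∀ p q → q + (p + q) ≡ p
    back = solve 2 (λ p q → q :+ (p :+ q) := p) refl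
    pull : ∀ P L → P on L → pt⁻ φ P on ln⁻ φ L
    pull P L = preserve (inverseAut φ) {P} {L}
    σ-axis : ∀ P → P on vert 0# → pt φ (pt τ (pt⁻ φ P)) ≡ P
    σ-axis P P∈ = case on-lineInf (preimage-on φ {P} φℓ P∈) of λ
      { (s , eq) → trans (cong (λ Q → pt φ (pt τ Q)) eq) (trans (cong (pt φ) (sym eq)) (pt-pt⁻ φ P)) }
    σ-centre : ∀ L → origin on L → ln φ (ln τ (ln⁻ φ L)) ≡ L
    σ-centre L O∈ = trans (cong (ln φ) (translation-direction s N
        (subst (_on N) centre≡ (pull origin (lin 0# 0#) (on-x-axis 0#)))
        (subst (_on N) p≡ (pull (slope 0#) (lin 0# 0#) refl))
        (subst (_on N) q≡ (pull (aff c 0#) (lin 0# 0#) (on-x-axis c)))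
        (ln⁻ φ L) (subst (_on ln⁻ φ L) centre≡ (pull origin L O∈))))
      (ln-ln⁻ φ L)
      where
      -- The x-axis contains the origin, (0) and (c, 0), so its preimage passes through the two
      -- points defining τ and through the preimage `inf s` of the centre.
      N : Line F
      N = ln⁻ φ (lin 0# 0#)

  through-∞ : ∀ {L} → ∞ on L → L ≡ lineInf ⊎ ∃ λ x → L ≡ vert x
  through-∞ {lineInf} _ = inj₁ refl
  through-∞ {vert x} _ = inj₂ (x , refl)

  vert-injective : ∀ {x y} → vert {F = F} x ≡ vert y → x ≡ y
  vert-injective refl = refl

  module _ {c u : Carrier} (c≢0 : c ≢ 0#) (c≢u : c ≢ u) (trc : tr c ≡ 0#) (E : ElationSwapping c) where
    open ElationSwapping E

    elation-∞ : pt σ ∞ ≡ ∞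
    elation-∞ = axis {∞} tt

    elation-vert-c : ln σ (vert c) ≡ lineInf
    elation-vert-c = joins-∞-slope (map-on σ {∞} {∞} {vert c} elation-∞ refl tt)
      (map-on σ {aff c 0#} {slope 0#} {vert c} ↦slope0 refl refl)

    elation-vert : ∃ λ f → ln σ (vert u) ≡ vert f
    elation-vert with through-∞ (map-on σ {∞} {∞} {vert u} elation-∞ refl tt)
    ... | inj₁ eq = ⊥-elim (c≢u (vert-injective (ln-injective σ (trans elation-vert-c (sym eq)))))
    ... | inj₂ f = f

    elation-meet : ∀ P L x a → P on L → P on lin a 0# → ln σ L ≡ vert x → pt σ P ≡ aff x (x ⊙ a)
    elation-meet P L x a P∈L P∈a L↦ = trans
      (meet-vert-lin (map-on σ {P} {_} {L} refl L↦ P∈L) (map-on σ {P} {_} {lin a 0#} refl (centre {lin a 0#} (origin-on-lin a)) P∈a))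
      (cong (aff x) (R.+-identityʳ _))

    -- Let x = u go to x = f. Lines through the origin are fixed, so (u, u ⊙ t) goes to (f, f ⊙ t).
    -- The horizontal line through it goes to the join of (0, u ⊙ t) and (c, 0), whose slope is s;
    -- incidence is the required equation.
    elation⇒harmonicSum : ∃ λ f → HarmonicSum c u f
    elation⇒harmonicSum with elation-vert
    ... | f , u↦f = f , harmonic
      where
      harmonic : HarmonicSum c u f
      harmonic s t cs≡ut with joins-y-axis-affine c≢0
          (map-on σ {aff 0# (u ⊙ t)} {_} {lin 0# (u ⊙ t)} (axis {aff 0# (u ⊙ t)} refl) refl (on-horizontal 0# (u ⊙ t)))
          (map-on σ {slope 0#} {_} {lin 0# (u ⊙ t)} slope0↦ refl refl)
      ... | a , L↦ , 0≡ = begin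
        f ⊙ (t + s)                        ≡⟨ ⊙-distribˡ f t s ⟩
        f ⊙ t + f ⊙ s                      ≡⟨ cong₂ _+_ on-image (cong (f ⊙_) (sym a≡s)) ⟩
        f ⊙ a + u ⊙ t + f ⊙ a              ≡⟨ solve 2 (λ p q → p :+ q :+ p := q) refl (f ⊙ a) (u ⊙ t) ⟩
        u ⊙ t                              ∎
        where
        open ≡-Reasoning
        a≡s : a ≡ s
        a≡s = ⊙-cancelˡ trc c≢0 (trans (x+y≡0⇒x≡y (sym 0≡)) (sym cs≡ut))
        on-image : aff f (f ⊙ t) on lin a (u ⊙ t)
        on-image = map-on σ {aff u (u ⊙ t)} {aff f (f ⊙ t)} {lin 0# (u ⊙ t)}
          (elation-meet (aff u (u ⊙ t)) (vert u) f t refl (on-product u t) u↦f) L↦ (on-horizontal u (u ⊙ t))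

  lineInf↦y-axis-impossible : 4 < n → ∀ φ → ln φ lineInf ≢ vert 0#
  lineInf↦y-axis-impossible 4<n φ φℓ = no-harmonicSums 4<n λ c u c≢0 u≢0 c≢u trc →
    elation⇒harmonicSum c≢0 c≢u trc (conjugate-translation φ φℓ c c≢0)

  lineInf↦vert-impossible : 4 < n → ∀ φ v → ln φ lineInf ≢ vert v
  lineInf↦vert-impossible 4<n φ v φℓ = lineInf↦y-axis-impossible 4<n (φ ⨾ translation v 0#)
    (trans (cong (ln (translation v 0#)) φℓ) (cong vert (x+x≡0 v)))

  lins-transitive : ∀ a b a′ b′ → ∃ λ g → ln g (lin a b) ≡ lin a′ b′
  lins-transitive a b a′ b′ = shear (a + a′) ⨾ translation 0# (b + b′) , cong₂ lin (x+[x+y]≡y a a′)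
    (trans (cong (λ z → b + (b + b′ + z)) (⊙-zeroˡ _)) (trans (cong (b +_) (R.+-identityʳ _)) (x+[x+y]≡y b b′)))

  -- If φ moved the line at infinity to an affine line not through (∞), then φ g φ with
  -- g moving that line suitably would move the line at infinity to a vertical line.
  lineInf-fixed : 4 < n → ∀ φ → ln φ lineInf ≡ lineInf
  lineInf-fixed 4<n φ = classify (ln φ lineInf) refl
    where
    classify : ∀ L → ln φ lineInf ≡ L → ln φ lineInf ≡ lineInf
    classify lineInf eq = eq
    classify (vert v) eq = ⊥-elim (lineInf↦vert-impossible 4<n φ v eq)
    classify (lin a b) eq = case off-lineInf ∞∉ of λ { (x , y , Q≡) → ⊥-elim (0≢1
        (vert-injective (ln-injective (inverseAut φ) (trans (preimage Q≡ 0#) (sym (preimage Q≡ 1#)))))) }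
      where
      ∞∉ : ¬ (pt⁻ φ ∞ on lineInf)
      ∞∉ = map-on φ {pt⁻ φ ∞} (pt-pt⁻ φ ∞) eq
      lin-preimage : ∀ v {a′ b′} → ln⁻ φ (vert v) ≢ lin a′ b′
      lin-preimage v {a′} {b′} pre with lins-transitive a b a′ b′
      ... | g , g≡ = lineInf↦vert-impossible 4<n (φ ⨾ g ⨾ φ) v
        (trans (cong (λ L → ln φ (ln g L)) eq) (trans (cong (ln φ) (trans g≡ (sym pre))) (ln-ln⁻ φ (vert v))))
      -- The preimage of every vertical line passes through the affine point (x, y) and is not of
      -- the form `lin`, so x = v has the same preimage for v = 0 and v = 1.
      preimage : ∀ {x y} → pt⁻ φ ∞ ≡ aff x y → ∀ v → ln⁻ φ (vert v) ≡ vert x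
      preimage {x} {y} Q≡ v = not-lin (ln⁻ φ (vert v)) refl (map-on (inverseAut φ) {∞} {_} {vert v} Q≡ refl tt)
        where
        not-lin : ∀ K → ln⁻ φ (vert v) ≡ K → aff x y on K → K ≡ vert x
        not-lin (lin _ _) K≡ _ = ⊥-elim (lin-preimage v K≡)
        not-lin (vert _) _ x≡ = cong vert (sym x≡)

  affine-image-off-lineInf : 4 < n → ∀ φ {x y} → ¬ (pt φ (aff x y) on lineInf)
  affine-image-off-lineInf 4<n φ {x} {y} h =
    reflect φ {aff x y} {lineInf} (subst (pt φ (aff x y) on_) (sym (lineInf-fixed 4<n φ)) h)

  record ElationTilting : Set where
    field
      σ          : Automorphism
      fixes-axis : ∀ {P} → P on lin 0# 0# → pt σ P ≡ P
      centre     : ∀ {L} → slope 0# on L → ln σ L ≡ L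
      y-axis↦    : ln σ (vert 0#) ≡ lin 1# 0#

  slope-injective : ∀ {a b} → slope a ≡ slope b → a ≡ b
  slope-injective refl = refl

  -- A shear has axis x = 0 and centre (∞), which φ carries to the x-axis and (0). The parameter p +
  -- p′ moves the preimage of (∞) to that of (1), so the conjugate takes (∞) to (1).
  conjugate-shear : 4 < n → ∀ φ → pt φ origin ≡ origin → pt φ ∞ ≡ slope 0# → ElationTilting
  conjugate-shear 4<n φ φO φ∞ with pull-inf nothing (λ ()) | pull-inf (just 1#) (λ eq → 0≢1 (sym (slope-injective eq)))
    where
    pull-inf : ∀ s → inf s ≢ slope 0# → ∃ λ p → pt⁻ φ (inf s) ≡ slope p
    pull-inf s s≢ with on-lineInf (map-on (inverseAut φ) {inf s} {_} {lineInf} refl (lineInf-fixed 4<n (inverseAut φ)) tt)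
    ... | nothing , eq = ⊥-elim (s≢ (trans (sym (pt-pt⁻ φ (inf s))) (trans (cong (pt φ) eq) φ∞)))
    ... | just p , eq = p , eq
  ... | p , p≡ | p′ , p′≡ = record
    { σ = inverseAut φ ⨾ τ ⨾ φ
    ; fixes-axis = λ {P} → σ-axis P
    ; centre = λ {L} s∈ → trans (cong (ln φ) (shear-vertical (ln⁻ φ L) (pull (slope 0#) L φ⁻-slope0 s∈))) (ln-ln⁻ φ L)
    ; y-axis↦ = trans (cong (λ L → ln φ (ln τ L)) (φ⁻-lin (vert 0#) tt refl p≡))
        (trans (cong (λ a → ln φ (lin a 0#)) (x+[x+y]≡y p p′))
          (trans (cong (ln φ) (sym (φ⁻-lin (lin 1# 0#) refl (origin-on-lin 1#) p′≡))) (ln-ln⁻ φ _))) }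
    where
    τ : Automorphism
    τ = shear (p + p′)
    φ⁻O : pt⁻ φ origin ≡ origin
    φ⁻O = trans (cong (pt⁻ φ) (sym φO)) (pt⁻-pt φ origin)
    φ⁻-slope0 : pt⁻ φ (slope 0#) ≡ ∞
    φ⁻-slope0 = trans (cong (pt⁻ φ) (sym φ∞)) (pt⁻-pt φ ∞)
    pull : ∀ P L {Q} → pt⁻ φ P ≡ Q → P on L → Q on ln⁻ φ L
    pull P L eq = map-on (inverseAut φ) {P} {_} {L} eq refl
    φ⁻-lin : ∀ {s a} L → inf s on L → origin on L → pt⁻ φ (inf s) ≡ slope a → ln⁻ φ L ≡ lin a 0#
    φ⁻-lin {s} L s∈ O∈ eq = joins-slope-y-axis (pull (inf s) L eq s∈) (pull origin L φ⁻O O∈)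
    σ-axis : ∀ P → P on lin 0# 0# → pt φ (pt τ (pt⁻ φ P)) ≡ P
    σ-axis P P∈ = trans (cong (pt φ) (shear-y-axis (pt⁻ φ P) (subst (pt⁻ φ P on_)
        (joins-∞-affine (pull (slope 0#) (lin 0# 0#) φ⁻-slope0 refl) (pull origin (lin 0# 0#) φ⁻O (on-x-axis 0#)))
        (pull P (lin 0# 0#) refl P∈))))
      (pt-pt⁻ φ P)
      where
      shear-y-axis : ∀ Q → Q on vert 0# → pt τ Q ≡ Q
      shear-y-axis (aff x y) x≡0 = cong (aff x) (trans (cong (λ z → y + z ⊙ (p + p′)) x≡0)
        (trans (cong (y +_) (⊙-zeroˡ _)) (R.+-identityʳ y)))
      shear-y-axis (inf nothing) _ = refl
    shear-vertical : ∀ M → ∞ on M → ln τ M ≡ M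
    shear-vertical lineInf _ = refl
    shear-vertical (vert _) _ = refl

  lin-slope-injective : ∀ {a b a′ b′} → lin {F = F} a b ≡ lin a′ b′ → a ≡ a′
  lin-slope-injective refl = refl

  -- Such an elation is the map (x , y) ↦ (x + y , y).
  module _ (4<n : 4 < n) (E : ElationTilting) where
    open ElationTilting E

    tilt-origin : pt σ origin ≡ origin
    tilt-origin = fixes-axis {origin} (on-x-axis 0#)

    tilt-∞ : pt σ ∞ ≡ slope 1#
    tilt-∞ = slope-of (pt σ ∞) (map-on σ {∞} {_} {lineInf} refl (lineInf-fixed 4<n σ) tt) (map-on σ {∞} {_} {vert 0#} refl y-axis↦ tt)
      where
      slope-of : ∀ P → P on lineInf → P on lin 1# 0# → P ≡ slope 1#
      slope-of (inf (just a)) _ a≡1 = cong slope a≡1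

    tilt-vert : ∀ x → ln σ (vert x) ≡ lin 1# x
    tilt-vert x = joins-slope-affine (map-on σ {∞} {_} {vert x} tilt-∞ refl tt)
      (map-on σ {aff x 0#} {_} {vert x} (fixes-axis {aff x 0#} (on-x-axis x)) refl refl)
      (sym (trans (cong (_+ x) (⊙-identityʳ x)) (x+x≡0 x)))

    tilt-affine : ∀ x y → pt σ (aff x y) ≡ aff (x + y) y
    tilt-affine x y = meet (pt σ (aff x y)) (map-on σ {aff x y} {_} {vert x} refl (tilt-vert x) refl)
        (map-on σ {aff x y} {_} {lin 0# y} refl (centre {lin 0# y} refl) (on-horizontal x y))
      where
      meet : ∀ P → P on lin 1# x → P on lin 0# y → P ≡ aff (x + y) y
      meet (aff X Y) Y≡ Y≡′ = cong₂ aff (begin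
          X                 ≡⟨ solve 2 (λ X x → X := x :+ (X :+ x)) refl X x ⟩
          x + (X + x)       ≡⟨ cong (λ z → x + (z + x)) (⊙-identityʳ X) ⟨
          x + (X ⊙ 1# + x)  ≡⟨ cong (x +_) (trans (sym Y≡) Y≡y) ⟩
          x + y             ∎) Y≡y
        where
        open ≡-Reasoning
        Y≡y : Y ≡ y
        Y≡y = trans Y≡′ (sym (on-horizontal X y))
      meet (inf (just a)) a≡1 a≡0 = ⊥-elim (0≢1 (trans (sym a≡0) a≡1))

    tilt-diagonal : ln σ (lin 1# 0#) ≡ vert 0#
    tilt-diagonal = joins-diagonal (ln σ (lin 1# 0#)) (map-on σ {origin} {_} {lin 1# 0#} tilt-origin refl (origin-on-lin 1#))
        (map-on σ {aff 1# 1#} {_} {lin 1# 0#} (trans (tilt-affine 1# 1#) (cong (λ z → aff z 1#) (x+x≡0 1#))) refl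
          (sym (trans (R.+-identityʳ _) (⊙-identityʳ 1#))))
      where
      joins-diagonal : ∀ L → origin on L → aff 0# 1# on L → L ≡ vert 0#
      joins-diagonal (vert a) 0≡a _ = cong vert (sym 0≡a)
      joins-diagonal (lin a b) 0≡ 1≡ = ⊥-elim (0≢1 (trans 0≡ (sym 1≡)))

    -- The line y = x ⊙ b goes to a line through the origin, not x = 0 since that is the image of
    -- the diagonal; c is its slope.
    tilt-quotient : ∀ b → b ≢ 1# → ∃ λ c → ∀ x → (x + x ⊙ b) ⊙ c ≡ x ⊙ b
    tilt-quotient b b≢1 with through-origin (map-on σ {origin} {_} {lin b 0#} tilt-origin refl (origin-on-lin b))
    ... | inj₁ eq = ⊥-elim (b≢1 (lin-slope-injective (ln-injective σ {lin b 0#} {lin 1# 0#} (trans eq (sym tilt-diagonal)))))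
    ... | inj₂ (c , eq) = c , λ x → trans (on-product (x + x ⊙ b) c)
      (sym (map-on σ {aff x (x ⊙ b)} {_} {lin b 0#} (tilt-affine x (x ⊙ b)) eq (on-product x b)))

  ∞↦slope0-impossible : 4 < n → ∀ φ → pt φ origin ≡ origin → pt φ ∞ ≢ slope 0#
  ∞↦slope0-impossible 4<n φ φO φ∞ = no-quotients 4<n (tilt-quotient 4<n (conjugate-shear 4<n φ φO φ∞))

  -- If (∞) went to (s), a translation returning the image of the origin and a shear taking (s) to
  -- (0) would produce the excluded situation.
  ∞-fixed : 4 < n → ∀ φ → pt φ ∞ ≡ ∞
  ∞-fixed 4<n φ with on-lineInf (map-on φ {∞} {_} {lineInf} refl (lineInf-fixed 4<n φ) tt)
      | off-lineInf (affine-image-off-lineInf 4<n φ {0#} {0#})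
  ... | nothing , eq | _ = eq
  ... | just s , eq | x , y , O≡ = ⊥-elim (∞↦slope0-impossible 4<n (φ ⨾ translation x y ⨾ shear s)
    (trans (cong (λ P → pt (shear s) (pt (translation x y) P)) O≡)
      (trans (cong₂ (λ u v → aff u (v + u ⊙ s)) (x+x≡0 x) (x+x≡0 y))
        (cong (aff 0#) (trans (R.+-identityˡ _) (⊙-zeroˡ s)))))
    (trans (cong (λ P → pt (shear s) (pt (translation x y) P)) eq) (cong slope (x+x≡0 s))))

-- Collineations between the hyperovals.

module Hyperovals {n : ℕ} (n-odd : n % 2 ≡ 1) (F : FiniteField2^ n) where
  open FiniteField2^ F
  open Arithmetic F
  open Trace n-odd F
  open Presemifield n-odd F
  open Plane n-odd F
  open Automorphism
  open Char2Solver using (solve; _:=_; _:+_)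

  -- The value 0 on points of the wrong kind is a default; the two lemmas recovering a point from
  -- its coordinates exclude it.
  xCoord yCoord slopeCoord : Point F → Carrier
  xCoord (aff x y) = x
  xCoord (inf _)   = 0#
  yCoord (aff x y) = y
  yCoord (inf _)   = 0#
  slopeCoord (inf (just a)) = a
  slopeCoord _              = 0#

  aff-cong⁻ : ∀ {x y x′ y′} → aff {F = F} x y ≡ aff x′ y′ → x ≡ x′ × y ≡ y′
  aff-cong⁻ refl = refl , refl

  affine-coordinates : ∀ {P} → ¬ (P on lineInf) → P ≡ aff (xCoord P) (yCoord P)
  affine-coordinates {aff x y} _ = refl
  affine-coordinates {inf s} off = ⊥-elim (off tt)

  slope-coordinate : ∀ {P} → P on lineInf → P ≢ ∞ → P ≡ slope (slopeCoord P)
  slope-coordinate {inf nothing} _ ≢∞ = ⊥-elim (≢∞ refl)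
  slope-coordinate {inf (just a)} _ _ = refl

  -- An automorphism fixing the origin, (0) and (1) has the form (x , y) ↦ (β x , β y), (a) ↦ (γ a).
  module FrameFixing (4<n : 4 < n) (φ : Automorphism)
    (φO : pt φ origin ≡ origin) (φ0 : pt φ (slope 0#) ≡ slope 0#) (φ1 : pt φ (slope 1#) ≡ slope 1#) where

    φ∞ : pt φ ∞ ≡ ∞
    φ∞ = ∞-fixed 4<n φ

    image : ∀ P L {Q M} → pt φ P ≡ Q → ln φ L ≡ M → P on L → Q on M
    image P L = map-on φ {P} {_} {L}

    affine-image : ∀ x y → pt φ (aff x y) ≡ aff (xCoord (pt φ (aff x y))) (yCoord (pt φ (aff x y)))
    affine-image x y = affine-coordinates (affine-image-off-lineInf 4<n φ {x} {y})

    β κ γ : Carrier → Carrier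
    β x = xCoord (pt φ (aff x 0#))
    κ y = yCoord (pt φ (aff 0# y))
    γ a = slopeCoord (pt φ (slope a))

    x-axis-image : ∀ x → pt φ (aff x 0#) ≡ aff (β x) 0#
    x-axis-image x = trans (affine-image x 0#) (cong (aff (β x))
      (trans (image (aff x 0#) (lin 0# 0#) (affine-image x 0#)
          (joins-slope-y-axis (image (slope 0#) (lin 0# 0#) φ0 refl refl) (image origin (lin 0# 0#) φO refl (on-x-axis 0#))) (on-x-axis x))
        (sym (on-x-axis (β x)))))

    y-axis-image : ∀ y → pt φ (aff 0# y) ≡ aff 0# (κ y)
    y-axis-image y = trans (affine-image 0# y) (cong (λ z → aff z (κ y))
      (image (aff 0# y) (vert 0#) (affine-image 0# y) (joins-∞-affine (image ∞ (vert 0#) φ∞ refl tt) (image origin (vert 0#) φO refl refl)) refl))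

    vert-image : ∀ x → ln φ (vert x) ≡ vert (β x)
    vert-image x = joins-∞-affine (image ∞ (vert x) φ∞ refl tt) (image (aff x 0#) (vert x) (x-axis-image x) refl refl)

    horizontal-image : ∀ y → ln φ (lin 0# y) ≡ lin 0# (κ y)
    horizontal-image y = joins-slope-y-axis (image (slope 0#) (lin 0# y) φ0 refl refl)
      (image (aff 0# y) (lin 0# y) (y-axis-image y) refl (on-horizontal 0# y))

    slope1-image : ∀ b → ln φ (lin 1# b) ≡ lin 1# (κ b)
    slope1-image b = joins-slope-y-axis (image (slope 1#) (lin 1# b) φ1 refl refl)
      (image (aff 0# b) (lin 1# b) (y-axis-image b) refl (sym (trans (cong (_+ b) (⊙-zeroˡ 1#)) (R.+-identityˡ b))))

    point-image-κ : ∀ x y → pt φ (aff x y) ≡ aff (β x) (κ y)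
    point-image-κ x y = trans
      (meet-vert-lin (image (aff x y) (vert x) refl (vert-image x) refl)
        (image (aff x y) (lin 0# y) refl (horizontal-image y) (on-horizontal x y)))
      (cong (aff (β x)) (sym (on-horizontal (β x) (κ y))))

    -- The point (x, x + b) lies on the line of slope 1 through (0, b), and slope 1 is fixed.
    -- Setting b = 0 identifies κ with β, and additivity follows.
    κ-sum : ∀ x b → κ (x + b) ≡ β x + κ b
    κ-sum x b = trans (image (aff x (x + b)) (lin 1# b) (point-image-κ x (x + b)) (slope1-image b) (cong (_+ b) (sym (⊙-identityʳ x))))
      (cong (_+ κ b) (⊙-identityʳ (β x)))

    κ-0 : κ 0# ≡ 0#
    κ-0 = cong yCoord φO

    κ≡β : ∀ x → κ x ≡ β x
    κ≡β x = begin
      κ x         ≡⟨ cong κ (R.+-identityʳ x) ⟨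
      κ (x + 0#)  ≡⟨ κ-sum x 0# ⟩
      β x + κ 0#  ≡⟨ cong (β x +_) κ-0 ⟩
      β x + 0#    ≡⟨ R.+-identityʳ (β x) ⟩
      β x         ∎
      where open ≡-Reasoning

    point-image : ∀ x y → pt φ (aff x y) ≡ aff (β x) (β y)
    point-image x y = trans (point-image-κ x y) (cong (aff (β x)) (κ≡β y))

    β-+ : Additive β
    β-+ x y = trans (sym (κ≡β (x + y))) (trans (κ-sum x y) (cong (β x +_) (κ≡β y)))

    β-kernel : ∀ x → β x ≡ 0# → x ≡ 0#
    β-kernel x βx≡0 = proj₁ (aff-cong⁻ (pt-injective φ (trans (x-axis-image x) (trans (cong (λ z → aff z 0#) βx≡0) (sym φO)))))

    slope-image : ∀ a → pt φ (slope a) ≡ slope (γ a)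
    slope-image a = slope-coordinate (image (slope a) lineInf refl (lineInf-fixed 4<n φ) tt)
      λ eq → case pt-injective φ (trans eq (sym φ∞)) of λ ()

    γ-surjective : ∀ b → ∃ λ a → γ a ≡ b
    γ-surjective b = a , slope-injective (trans (sym (slope-image a)) (trans (cong (pt φ) (sym a≡)) (pt-pt⁻ φ (slope b))))
      where
      a : Carrier
      a = slopeCoord (pt⁻ φ (slope b))
      a≡ : pt⁻ φ (slope b) ≡ slope a
      a≡ = slope-coordinate (map-on (inverseAut φ) {slope b} {_} {lineInf} refl (lineInf-fixed 4<n (inverseAut φ)) tt)
        λ eq → case trans (sym (pt-pt⁻ φ (slope b))) (trans (cong (pt φ) eq) φ∞) of λ ()

    β-⊙ : ∀ x a → β (x ⊙ a) ≡ β x ⊙ γ a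
    β-⊙ x a = trans (image (aff x (x ⊙ a)) (lin a 0#) (point-image x (x ⊙ a))
        (joins-slope-y-axis (image (slope a) (lin a 0#) (slope-image a) refl refl) (image origin (lin a 0#) φO refl (origin-on-lin a)))
        (on-product x a))
      (R.+-identityʳ _)

  MapsInto : Automorphism → PointSet F → PointSet F → Set
  MapsInto φ A B = ∀ P → A P → B (pt φ P)

  -- The affine part is the graph of an additive map, hence a subgroup that acts on itself.
  translation-hyperoval : ∀ k y → MapsInto (translation (frob k y + y) y) (O F k) (O F k)
  translation-hyperoval k y (aff u v) u≡ = trans (cong (_+ (frob k y + y)) u≡) (trans
    (solve 4 (λ p q r s → (p :+ q) :+ (r :+ s) := (p :+ r) :+ (q :+ s)) refl (frob k v) v (frob k y) y)
    (cong (_+ (v + y)) (sym (frob-+ k v y))))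
  translation-hyperoval k y (inf (just a)) a∈ = a∈

  -- The shear adds the first coordinate to the second, making it v^(2^k). With this as new
  -- parameter, v is its image under `frob l`, and the first coordinate has the form required for l.
  shear-hyperoval : ∀ k l → (∀ y → frob l (frob k y) ≡ y) → MapsInto (shear 1#) (O F k) (O F l)
  shear-hyperoval k l inv (aff u v) u≡ = begin
    u                                            ≡⟨ u≡ ⟩
    frob k v + v                                 ≡⟨ R.+-comm _ _ ⟩
    v + frob k v                                 ≡⟨ cong (_+ frob k v) (inv v) ⟨
    frob l (frob k v) + frob k v                 ≡⟨ cong (λ z → frob l z + z) v′≡ ⟨
    frob l (v + u ⊙ 1#) + (v + u ⊙ 1#)           ∎
    where
    open ≡-Reasoning
    v′≡ : v + u ⊙ 1# ≡ frob k v
    v′≡ = begin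
      v + u ⊙ 1#           ≡⟨ cong (v +_) (trans (⊙-identityʳ u) u≡) ⟩
      v + (frob k v + v)   ≡⟨ solve 2 (λ v w → v :+ (w :+ v) := w) refl v (frob k v) ⟩
      frob k v             ∎
  shear-hyperoval k l inv (inf (just a)) (inj₁ a≡0) = inj₂ (trans (cong (_+ 1#) a≡0) (R.+-identityˡ 1#))
  shear-hyperoval k l inv (inf (just a)) (inj₂ a≡1) = inj₁ (trans (cong (_+ 1#) a≡1) (x+x≡0 1#))

  frame-fixing⇒frob≡ : 4 < n → ∀ {d e} → gcd n d ≡ 1 → (∀ x → frob e x ≡ x → IsBit x) →
    ∀ φ → MapsInto φ (O F d) (O F e) →
    pt φ origin ≡ origin → pt φ (slope 0#) ≡ slope 0# → pt φ (slope 1#) ≡ slope 1# → ∀ x → frob d x ≡ frob e x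
  frame-fixing⇒frob≡ 4<n {d} {e} d-coprime e-fixed φ φ-O φO φ0 φ1 =
    Rigidity.frob-d≡frob-e 4<n {d} {e} d-coprime e-fixed β γ β-+ β-kernel β-⊙ β-frob γ-surjective
    where
    open FrameFixing 4<n φ φO φ0 φ1
    open Autotopism n-odd F
    β-frob : ∀ y → β (frob d y) ≡ frob e (β y)
    -- Membership of the image of (y^(2^d) + y, y) in the target is the claim with β y added on both
    -- sides.
    β-frob y = +-cancelʳ (β y) (trans (sym (β-+ _ _))
      (subst (O F e) (point-image (frob d y + y) y) (φ-O (aff (frob d y + y) y) refl)))

  hyperoval-slope : ∀ e {P} → P on lineInf → O F e P → P ≡ slope 0# ⊎ P ≡ slope 1#
  hyperoval-slope e {inf (just a)} _ (inj₁ a≡0) = inj₁ (cong slope a≡0)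
  hyperoval-slope e {inf (just a)} _ (inj₂ a≡1) = inj₂ (cong slope a≡1)

  -- Translations along O_e and, if needed, the shear swapping (0) and (1) make φ fix the frame.
  maps-hyperoval⇒ : 4 < n → ∀ d e → gcd n d ≡ 1 → gcd n e ≡ 1 → ∀ φ → MapsInto φ (O F d) (O F e) →
    d % n ≡ e % n ⊎ (d ℕ.+ e) % n ≡ 0
  maps-hyperoval⇒ 4<n d e d-coprime e-coprime φ φ-O =
    decide (on-slopes 0# (inj₁ refl)) (on-slopes 1# (inj₂ refl))
    where
    x₀ y₀ : Carrier
    x₀ = xCoord (pt φ origin)
    y₀ = yCoord (pt φ origin)
    φO : pt φ origin ≡ aff x₀ y₀
    φO = affine-coordinates (affine-image-off-lineInf 4<n φ {0#} {0#})
    x₀≡ : x₀ ≡ frob e y₀ + y₀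
    x₀≡ = subst (O F e) φO (φ-O origin (sym (trans (cong (_+ 0#) (frob-0 d)) (R.+-identityʳ 0#))))
    τ ψ : Automorphism
    τ = translation (frob e y₀ + y₀) y₀
    ψ = φ ⨾ τ
    ψ-O : MapsInto ψ (O F d) (O F e)
    ψ-O P P∈ = translation-hyperoval e y₀ (pt φ P) (φ-O P P∈)
    ψO : pt ψ origin ≡ origin
    ψO = trans (cong (pt τ) φO) (cong₂ aff (trans (cong (_+ (frob e y₀ + y₀)) x₀≡) (x+x≡0 _)) (x+x≡0 y₀))
    on-slopes : ∀ a → IsBit a → pt ψ (slope a) ≡ slope 0# ⊎ pt ψ (slope a) ≡ slope 1#
    on-slopes a a-bit = hyperoval-slope e {pt ψ (slope a)}
      (map-on ψ {slope a} {_} {lineInf} refl (lineInf-fixed 4<n ψ) tt) (ψ-O (slope a) a-bit)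
    distinct : ∀ {Q} → pt ψ (slope 0#) ≡ Q → pt ψ (slope 1#) ≡ Q → ⊥
    distinct eq₀ eq₁ = 0≢1 (slope-injective (pt-injective ψ (trans eq₀ (sym eq₁))))
    e′ : ℕ
    -- A nonnegative representative of -e modulo n, so `frob e′` inverts `frob e`.
    e′ = (n ∸ 1) ℕ.* e
    e′-inverse : ∀ y → frob e′ (frob e y) ≡ y
    e′-inverse y = begin
      frob e′ (frob e y)         ≡⟨ frob-comm e′ e y ⟩
      frob e (frob e′ y)         ≡⟨ frob-∘ e e′ y ⟨
      frob (e ℕ.+ e′) y          ≡⟨ cong (λ m → frob (m ℕ.* e) y) (ℕ.suc-pred n) ⟩
      frob (n ℕ.* e) y           ≡⟨ cong (λ m → frob m y) (ℕ.*-comm n e) ⟩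
      frob (e ℕ.* n) y           ≡⟨ frob-periodic 0 e y ⟩
      y                          ∎
      where open ≡-Reasoning
    e′-fixed : ∀ x → frob e′ x ≡ x → IsBit x
    e′-fixed x eq = frob-fixed⇒bit e e-coprime x (trans (cong (frob e) (sym eq)) (trans (frob-comm e e′ x) (e′-inverse x)))
    decide : pt ψ (slope 0#) ≡ slope 0# ⊎ pt ψ (slope 0#) ≡ slope 1# →
      pt ψ (slope 1#) ≡ slope 0# ⊎ pt ψ (slope 1#) ≡ slope 1# → d % n ≡ e % n ⊎ (d ℕ.+ e) % n ≡ 0
    decide (inj₁ eq₀) (inj₁ eq₁) = ⊥-elim (distinct eq₀ eq₁)
    decide (inj₂ eq₀) (inj₂ eq₁) = ⊥-elim (distinct eq₀ eq₁)
    decide (inj₁ eq₀) (inj₂ eq₁) = inj₁ (frob-injective-mod d e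
      (frame-fixing⇒frob≡ 4<n d-coprime (frob-fixed⇒bit e e-coprime) ψ ψ-O ψO eq₀ eq₁))
    decide (inj₂ eq₀) (inj₁ eq₁) = inj₂ (trans (frob-injective-mod (d ℕ.+ e) 0 period) (ℕ.m<n⇒m%n≡m (ℕ.>-nonZero⁻¹ n)))
      where
      -- As ψ exchanges (0) and (1), the shear by 1 restores them, keeps the origin and replaces the
      -- target exponent e by e′.
      frob-d≡frob-e′ : ∀ x → frob d x ≡ frob e′ x
      frob-d≡frob-e′ = frame-fixing⇒frob≡ 4<n d-coprime e′-fixed (ψ ⨾ shear 1#)
        (λ P P∈ → shear-hyperoval e e′ e′-inverse (pt ψ P) (ψ-O P P∈))
        (trans (cong (pt (shear 1#)) ψO) (cong (aff 0#) (trans (R.+-identityˡ _) (⊙-zeroˡ 1#))))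
        (trans (cong (pt (shear 1#)) eq₀) (cong slope (x+x≡0 1#)))
        (trans (cong (pt (shear 1#)) eq₁) (cong slope (R.+-identityˡ 1#)))
      period : ∀ x → frob (d ℕ.+ e) x ≡ x
      period x = trans (frob-∘ d e x) (trans (frob-d≡frob-e′ (frob e x)) (e′-inverse x))

  equivalent⇒ : 4 < n → ∀ d e → gcd n d ≡ 1 → gcd n e ≡ 1 → Equivalent F (O F d) (O F e) →
    d % n ≡ e % n ⊎ (d ℕ.+ e) % n ≡ 0
  equivalent⇒ 4<n d e d-coprime e-coprime (c , c-O) =
    maps-hyperoval⇒ 4<n d e d-coprime e-coprime (fromCollineation c) (λ P → proj₁ (c-O P))

  equal⇒equivalent : ∀ d e → (∀ y → frob d y ≡ frob e y) → Equivalent F (O F d) (O F e)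
  equal⇒equivalent d e eq = toCollineation (involution (λ P → P) (λ L → L) (λ _ → refl) (λ _ → refl) (λ _ _ h → h)) , λ P → same P
    where
    same : ∀ P → (O F d P → O F e P) × (O F e P → O F d P)
    same (aff x y) = (λ h → trans h (cong (_+ y) (eq y))) , (λ h → trans h (cong (_+ y) (sym (eq y))))
    same (inf nothing) = (λ ()) , (λ ())
    same (inf (just a)) = (λ h → h) , (λ h → h)

  inverse⇒equivalent : ∀ d e → (∀ y → frob e (frob d y) ≡ y) → Equivalent F (O F d) (O F e)
  inverse⇒equivalent d e inv = toCollineation (shear 1#) , λ P →
    shear-hyperoval d e inv P ,
    λ h → subst (O F d) (pt-pt⁻ (shear 1#) P)
      (shear-hyperoval e d (λ y → trans (frob-comm d e y) (inv y)) (pt (shear 1#) P) h)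

  ⇒equivalent : ∀ d e → d % n ≡ e % n ⊎ (d ℕ.+ e) % n ≡ 0 → Equivalent F (O F d) (O F e)
  ⇒equivalent d e (inj₁ eq) = equal⇒equivalent d e λ y →
    trans (sym (frob-mod d y)) (trans (cong (λ k → frob k y) eq) (frob-mod e y))
  ⇒equivalent d e (inj₂ eq) = inverse⇒equivalent d e λ y → begin
    frob e (frob d y)         ≡⟨ frob-comm e d y ⟩
    frob d (frob e y)         ≡⟨ frob-∘ d e y ⟨
    frob (d ℕ.+ e) y          ≡⟨ frob-mod (d ℕ.+ e) y ⟨
    frob ((d ℕ.+ e) % n) y    ≡⟨ cong (λ k → frob k y) eq ⟩
    y                         ∎
    where open ≡-Reasoning

-- The residue condition for small n.

coprime-residue≢0 : ∀ n d → .{{_ : NonZero n}} → gcd n d ≡ 1 → n ≢ 1 → d % n ≢ 0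
coprime-residue≢0 n d coprime n≢1 d%n≡0 =
  n≢1 (∣1⇒≡1 (subst (n ∣_) coprime (gcd-greatest ∣-refl (m%n≡0⇒n∣m d n d%n≡0))))

-- The residues prime to 3 are 1 and -1, so any two are equal or opposite.
opposite-mod3 : ∀ d e → gcd 3 d ≡ 1 → gcd 3 e ≡ 1 → d % 3 ≡ e % 3 ⊎ (d ℕ.+ e) % 3 ≡ 0
opposite-mod3 d e d-coprime e-coprime = residues (d % 3) (e % 3) refl refl (ℕ.m%n<n d 3) (ℕ.m%n<n e 3)
  where
  sum : ∀ {i j} → d % 3 ≡ i → e % 3 ≡ j → (d ℕ.+ e) % 3 ≡ (i ℕ.+ j) % 3
  sum i≡ j≡ = trans (ℕ.%-distribˡ-+ d e 3) (cong₂ (λ i j → (i ℕ.+ j) % 3) i≡ j≡)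
  residues : ∀ i j → d % 3 ≡ i → e % 3 ≡ j → i < 3 → j < 3 → d % 3 ≡ e % 3 ⊎ (d ℕ.+ e) % 3 ≡ 0
  residues 0 _ i≡ _ _ _ = ⊥-elim (coprime-residue≢0 3 d d-coprime (λ ()) i≡)
  residues _ 0 _ j≡ _ _ = ⊥-elim (coprime-residue≢0 3 e e-coprime (λ ()) j≡)
  residues 1 1 i≡ j≡ _ _ = inj₁ (trans i≡ (sym j≡))
  residues 2 2 i≡ j≡ _ _ = inj₁ (trans i≡ (sym j≡))
  residues 1 2 i≡ j≡ _ _ = inj₂ (sum i≡ j≡)
  residues 2 1 i≡ j≡ _ _ = inj₂ (sum i≡ j≡)
  residues (ℕ.suc (ℕ.suc (ℕ.suc _))) _ _ _ (s≤s (s≤s (s≤s ()))) _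
  residues _ (ℕ.suc (ℕ.suc (ℕ.suc _))) _ _ _ (s≤s (s≤s (s≤s ())))

-- Oddness leaves n = 1, where all residues coincide, and n = 3.
small-n : ∀ n d e → .{{_ : NonZero n}} → n % 2 ≡ 1 → n ≤ 4 → gcd n d ≡ 1 → gcd n e ≡ 1 →
  d % n ≡ e % n ⊎ (d ℕ.+ e) % n ≡ 0
small-n 1 d e _ _ _ _ = inj₁ (trans (ℕ.n%1≡0 d) (sym (ℕ.n%1≡0 e)))
small-n 3 d e _ _ d-coprime e-coprime = opposite-mod3 d e d-coprime e-coprime
small-n (ℕ.suc (ℕ.suc (ℕ.suc (ℕ.suc (ℕ.suc _))))) d e _ (s≤s (s≤s (s≤s (s≤s ()))))

open import Data.Nat using (_+_)

theorem4p2 : (n : ℕ) → .{{_ : NonZero n}} → n % 2 ≡ 1 →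
    (d e : ℕ) → 0 < d → 0 < e → gcd n d ≡ 1 → gcd n e ≡ 1 →
    (F : FiniteField2^ n) →
    (Equivalent F (O F d) (O F e) → (d % n ≡ e % n ⊎ (d + e) % n ≡ 0)) ×
    ((d % n ≡ e % n ⊎ (d + e) % n ≡ 0) → Equivalent F (O F d) (O F e))
theorem4p2 n n-odd d e _ _ d-coprime e-coprime F = forward , Hyperovals.⇒equivalent n-odd F d e
  where
  forward : Equivalent F (O F d) (O F e) → d % n ≡ e % n ⊎ (d + e) % n ≡ 0
  forward eqv with ℕ.≤-<-connex n 4
  ... | inj₁ n≤4 = small-n n d e n-odd n≤4 d-coprime e-coprime
  ... | inj₂ 4<n = Hyperovals.equivalent⇒ n-odd F 4<n d e d-coprime e-coprime eqv
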